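{- Let $\gamma \geq 0$ be an integer. The operad $\mathsf{DAs}_\gamma$ admits the following presentation. It is generated by $\{\diamond_b : b \in [\gamma]\}$ and its space of relations is generated by $$\diamond_a \circ_1 \diamond_a - \diamond_a \circ_2 \diamond_a, \qquad a \in [\gamma].$$
   Context: The ground field has characteristic zero; operad means nonsymmetric operad; $[n] = \{1, \dots, n\}$; $a \uparrow a' := \max(a, a')$. $\mathbf{Free}(\mathfrak{G})$ is the free operad on a set $\mathfrak{G}$ of binary generators; $(\mathfrak{G}, \mathfrak{R})$ is a presentation of $\mathcal{O}$ if $\mathcal{O} \cong \mathbf{Free}(\mathfrak{G})/\langle \mathfrak{R} \rangle$. $\mathsf{As}_\gamma$ is the operad with presentation given by binary generators $\star_a$, $a \in [\gamma]$, and the space of relations generated by $\star_a \circ_1 \star_{a'} - \star_{a \uparrow a'} \circ_2 \star_{a \uparrow a'}$ and $\star_a \circ_2 \star_{a'} - \star_{a \uparrow a'} \circ_2 \star_{a \uparrow a'}$, $a, a' \in [\gamma]$. Koszul dual: if $\mathcal{O}$ has a presentation $(\mathfrak{G}, \mathfrak{R})$ with $\mathfrak{G}$ in arity $2$ and $\mathfrak{R} \subseteq \mathbf{Free}(\mathfrak{G})(3)$, its Koszul dual is $\mathbf{Free}(\mathfrak{G})/\langle \mathfrak{R}^\perp \rangle$, where $\mathfrak{R}^\perp$ is the annihilator of $\mathfrak{R}$ in $\mathbf{Free}(\mathfrak{G})(3)$ for the bilinear form with $\langle x \circ_i y, x' \circ_{i'} y' \rangle = 1$ if $x = x', y = y',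 i = i' = 1$; $= -1$ if $x = x', y = y', i = i' = 2$; and $0$ otherwise ($x, x', y, y' \in \mathfrak{G}$). $\mathsf{DAs}_\gamma$ is the Koszul dual of $\mathsf{As}_\gamma$ computed from this presentation, where in the dual the generator corresponding to $\star_a$ is denoted by $\lozenge_a$. In $\mathbf{Free}(\{\lozenge_a : a \in [\gamma]\})(2)$ set $\diamond_b := \sum_{a \in [b]} \lozenge_a$ for $b \in [\gamma]$. These elements form a basis of this space, so that the free operads on $\{\lozenge_a\}$ and on $\{\diamond_b\}$ are identified. -}

module Defs where

open import Algebra.Apartness.Bundles using (HeytingCommutativeRing; HeytingField)
open import Algebra.Bundles using (CommutativeRing; Ring)
import Algebra.Construct.NaturalChoice.Max as Max
import Algebra.Definitions.RawMonoid as RawMonoidDefinitions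
open import Algebra.Module.Bundles using (LeftModule)
open import Algebra.Module.Construct.TensorUnit using () renaming (leftModule to regularModule)
import Algebra.Module.Morphism.Construct.Composition as Composition
open import Algebra.Module.Morphism.Structures using (module LeftModuleMorphisms)
import Algebra.Properties.AbelianGroup as AbelianGroupProperties
open import Data.Bool.Base using (if_then_else_; _∧_)
open import Data.Fin.Base using (Fin; zero; suc; toℕ)
import Data.Fin.Properties as Fin
open import Data.List.Base using (allFin; filter; foldr; map)
open import Data.Nat.Base using (ℕ; zero; suc; _+_; _∸_; _<_; s≤s)
import Data.Nat.Properties as ℕ
open import Data.Product.Base using (_,_; proj₁; proj₂)
open import Level using (Level; _⊔_; 0ℓ) renaming (suc to lsuc)
open import Relation.Binary.Core using (Rel)
open import Relation.Binary.Definitions using (DecidableEquality)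
open import Relation.Binary.PropositionalEquality as ≡ using (_≡_; refl; cong)
open import Relation.Nullary using (yes; no; does; contradiction)
open import Relation.Nullary.Decidable using (recompute)
open import Relation.Unary using (Pred)

private
  variable
    a c ℓ ℓ₁ ℓ₂ m m₁ m₂ ℓm p : Level

module _ {R : Ring c ℓ} where
  open Ring R using (Carrier; 0#)

  IsLinear : (M : LeftModule R m₁ ℓ₁) (N : LeftModule R m₂ ℓ₂) →
             (LeftModule.Carrierᴹ M → LeftModule.Carrierᴹ N) → Set _
  IsLinear M N = IsLeftModuleHomomorphism
    where open LeftModuleMorphisms (LeftModule.rawLeftModule M) (LeftModule.rawLeftModule N)

  IsLinearIso : (M : LeftModule R m₁ ℓ₁) (N : LeftModule R m₂ ℓ₂) →
                (LeftModule.Carrierᴹ M → LeftModule.Carrierᴹ N) → Set _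
  IsLinearIso M N = IsLeftModuleIsomorphism
    where open LeftModuleMorphisms (LeftModule.rawLeftModule M) (LeftModule.rawLeftModule N)

  module _ (M : LeftModule R m₁ ℓ₁) (N : LeftModule R m₂ ℓ₂)
           (f : LeftModule.Carrierᴹ M → LeftModule.Carrierᴹ N) where
    private
      module M = LeftModule M
      module N = LeftModule N

    mkLinear : (∀ {x y} → x M.≈ᴹ y → f x N.≈ᴹ f y) →
               (∀ x y → f (x M.+ᴹ y) N.≈ᴹ f x N.+ᴹ f y) →
               (∀ r x → f (r M.*ₗ x) N.≈ᴹ r N.*ₗ f x) →
               IsLinear M N f
    mkLinear f-cong f-+ f-* = record
      { +ᴹ-isGroupHomomorphism = record
        { isMonoidHomomorphism = record
          { isMagmaHomomorphism = record
            { isRelHomomorphism = record { cong = f-cong }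
            ; homo              = f-+
            }
          ; ε-homo = f-0
          }
        ; ⁻¹-homo = f-neg
        }
      ; *ₗ-homo = f-*
      }
      where
      f-0 : f M.0ᴹ N.≈ᴹ N.0ᴹ
      f-0 = N.≈ᴹ-trans (f-cong (M.≈ᴹ-sym (M.*ₗ-zeroˡ M.0ᴹ)))
           (N.≈ᴹ-trans (f-* 0# M.0ᴹ) (N.*ₗ-zeroˡ (f M.0ᴹ)))

      f-neg : ∀ x → f (M.-ᴹ x) N.≈ᴹ N.-ᴹ f x
      f-neg x = AbelianGroupProperties.inverseʳ-unique N.+ᴹ-abelianGroup (f x) (f (M.-ᴹ x))
        (N.≈ᴹ-trans (N.≈ᴹ-sym (f-+ x (M.-ᴹ x)))
        (N.≈ᴹ-trans (f-cong (proj₂ M.-ᴹ‿inverse x)) f-0))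

  module Linear (M : LeftModule R m₁ ℓ₁) (N : LeftModule R m₂ ℓ₂)
                {f : LeftModule.Carrierᴹ M → LeftModule.Carrierᴹ N} (f-linear : IsLinear M N f)
    where open LeftModuleMorphisms.IsLeftModuleHomomorphism f-linear public

  module _ (M : LeftModule R m ℓm) where
    open LeftModule M

    data Span (S : Pred Carrierᴹ p) : Pred Carrierᴹ (c ⊔ m ⊔ ℓm ⊔ p) where
      gen  : ∀ {x} → S x → Span S x
      0∈   : Span S 0ᴹ
      +∈   : ∀ {x y} → Span S x → Span S y → Span S (x +ᴹ y)
      *∈   : ∀ r {x} → Span S x → Span S (r *ₗ x)
      resp : ∀ {x y} → x ≈ᴹ y → Span S x → Span S y

-- The free module on a set A, as formal linear expressions modulo the
-- smallest congruence satisfying the module axioms.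
module _ (R : Ring c ℓ) (A : Set a) where
  private module R = Ring R

  infixl 6 _⊕_
  infixr 7 _⊛_

  data Expr : Set (a ⊔ c) where
    var : A → Expr
    𝟎   : Expr
    _⊕_ : Expr → Expr → Expr
    _⊛_ : R.Carrier → Expr → Expr

  infix 4 _≋_

  data _≋_ : Rel Expr (a ⊔ c ⊔ ℓ) where
    ≋-refl      : ∀ {x} → x ≋ x
    ≋-sym       : ∀ {x y} → x ≋ y → y ≋ x
    ≋-trans     : ∀ {x y z} → x ≋ y → y ≋ z → x ≋ z
    ⊕-cong      : ∀ {x y u v} → x ≋ y → u ≋ v → x ⊕ u ≋ y ⊕ v
    ⊛-cong      : ∀ {r s x y} → r R.≈ s → x ≋ y → r ⊛ x ≋ s ⊛ y
    ⊕-assoc     : ∀ x y z → (x ⊕ y) ⊕ z ≋ x ⊕ (y ⊕ z)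
    ⊕-comm      : ∀ x y → x ⊕ y ≋ y ⊕ x
    ⊕-identityˡ : ∀ x → 𝟎 ⊕ x ≋ x
    ⊛-zeroˡ     : ∀ x → R.0# ⊛ x ≋ 𝟎
    ⊛-identityˡ : ∀ x → R.1# ⊛ x ≋ x
    ⊛-assoc     : ∀ r s x → (r R.* s) ⊛ x ≋ r ⊛ s ⊛ x
    ⊛-distribˡ  : ∀ r x y → r ⊛ (x ⊕ y) ≋ (r ⊛ x) ⊕ (r ⊛ y)
    ⊛-distribʳ  : ∀ x r s → (r R.+ s) ⊛ x ≋ (r ⊛ x) ⊕ (s ⊛ x)

  private
    neg : Expr → Expr
    neg x = (R.- R.1#) ⊛ x

    neg-inverseʳ : ∀ x → x ⊕ neg x ≋ 𝟎
    neg-inverseʳ x =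
      ≋-trans (⊕-cong (≋-sym (⊛-identityˡ x)) ≋-refl)
      (≋-trans (≋-sym (⊛-distribʳ x R.1# (R.- R.1#)))
      (≋-trans (⊛-cong (R.-‿inverseʳ R.1#) ≋-refl) (⊛-zeroˡ x)))

    ⊛-zeroʳ : ∀ r → r ⊛ 𝟎 ≋ 𝟎
    ⊛-zeroʳ r =
      ≋-trans (⊛-cong R.refl (≋-sym (⊛-zeroˡ 𝟎)))
      (≋-trans (≋-sym (⊛-assoc r R.0# 𝟎))
      (≋-trans (⊛-cong (R.zeroʳ r) ≋-refl) (⊛-zeroˡ 𝟎)))

  FreeModule : LeftModule R (a ⊔ c) (a ⊔ c ⊔ ℓ)
  FreeModule = record
    { Carrierᴹ = Expr
    ; _≈ᴹ_ = _≋_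
    ; _+ᴹ_ = _⊕_
    ; _*ₗ_ = _⊛_
    ; 0ᴹ = 𝟎
    ; -ᴹ_ = neg
    ; isLeftModule = record
      { isLeftSemimodule = record
        { +ᴹ-isCommutativeMonoid = record
          { isMonoid = record
            { isSemigroup = record
              { isMagma = record
                { isEquivalence = record { refl = ≋-refl ; sym = ≋-sym ; trans = ≋-trans }
                ; ∙-cong = ⊕-cong
                }
              ; assoc = ⊕-assoc
              }
            ; identity = ⊕-identityˡ , λ x → ≋-trans (⊕-comm x 𝟎) (⊕-identityˡ x)
            }
          ; comm = ⊕-comm
          }
        ; isPreleftSemimodule = record
          { *ₗ-cong = ⊛-cong
          ; *ₗ-zeroˡ = ⊛-zeroˡ
          ; *ₗ-distribʳ = ⊛-distribʳ
          ; *ₗ-identityˡ = ⊛-identityˡ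
          ; *ₗ-assoc = ⊛-assoc
          ; *ₗ-zeroʳ = ⊛-zeroʳ
          ; *ₗ-distribˡ = ⊛-distribˡ
          }
        }
      ; -ᴹ‿cong = ⊛-cong R.refl
      ; -ᴹ‿inverse = (λ x → ≋-trans (⊕-comm (neg x) x) (neg-inverseʳ x)) , neg-inverseʳ
      }
    }

module _ {R : Ring c ℓ} {A : Set a} (M : LeftModule R m ℓm) where
  open LeftModule M

  extend : (A → Carrierᴹ) → Expr R A → Carrierᴹ
  extend f (var x) = f x
  extend f 𝟎       = 0ᴹ
  extend f (x ⊕ y) = extend f x +ᴹ extend f y
  extend f (r ⊛ x) = r *ₗ extend f x

  extend-cong : ∀ f {x y} → _≋_ R A x y → extend f x ≈ᴹ extend f y
  extend-cong f ≋-refl             = ≈ᴹ-refl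
  extend-cong f (≋-sym e)          = ≈ᴹ-sym (extend-cong f e)
  extend-cong f (≋-trans e e′)     = ≈ᴹ-trans (extend-cong f e) (extend-cong f e′)
  extend-cong f (⊕-cong e e′)      = +ᴹ-cong (extend-cong f e) (extend-cong f e′)
  extend-cong f (⊛-cong r e)       = *ₗ-cong r (extend-cong f e)
  extend-cong f (⊕-assoc x y z)    = +ᴹ-assoc _ _ _
  extend-cong f (⊕-comm x y)       = +ᴹ-comm _ _
  extend-cong f (⊕-identityˡ x)    = +ᴹ-identityˡ _
  extend-cong f (⊛-zeroˡ x)        = *ₗ-zeroˡ _
  extend-cong f (⊛-identityˡ x)    = *ₗ-identityˡ _
  extend-cong f (⊛-assoc r s x)    = *ₗ-assoc r s _
  extend-cong f (⊛-distribˡ r x y) = *ₗ-distribˡ r _ _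
  extend-cong f (⊛-distribʳ x r s) = *ₗ-distribʳ _ r s

  extend-linear : ∀ f → IsLinear (FreeModule R A) M (extend f)
  extend-linear f = mkLinear (FreeModule R A) M (extend f)
    (extend-cong f) (λ _ _ → ≈ᴹ-refl) (λ _ _ → ≈ᴹ-refl)

  module _ {f g : Expr R A → Carrierᴹ}
           (f-linear : IsLinear (FreeModule R A) M f)
           (g-linear : IsLinear (FreeModule R A) M g)
           (f≈g : ∀ x → f (var x) ≈ᴹ g (var x)) where
    private
      module f = Linear (FreeModule R A) M f-linear
      module g = Linear (FreeModule R A) M g-linear

    linear-ext : ∀ x → f x ≈ᴹ g x
    linear-ext (var x) = f≈g x
    linear-ext 𝟎       = ≈ᴹ-trans f.0ᴹ-homo (≈ᴹ-sym g.0ᴹ-homo)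
    linear-ext (x ⊕ y) = ≈ᴹ-trans (f.+ᴹ-homo x y)
      (≈ᴹ-trans (+ᴹ-cong (linear-ext x) (linear-ext y)) (≈ᴹ-sym (g.+ᴹ-homo x y)))
    linear-ext (r ⊛ x) = ≈ᴹ-trans (f.*ₗ-homo r x)
      (≈ᴹ-trans (*ₗ-congˡ (linear-ext x)) (≈ᴹ-sym (g.*ₗ-homo r x)))

module _ (R : CommutativeRing c ℓ) where
  private module R = CommutativeRing R

  -- Indices of partial compositions are counted from 0, so that
  -- compose x i y is x ∘₁₊ᵢ y.  The arity of a composite is constrained by
  -- an irrelevant equation rather than computed, so that the axioms can be
  -- stated without transport.
  record Operad m ℓm : Set (c ⊔ ℓ ⊔ lsuc (m ⊔ ℓm)) where
    field
      space : ℕ → LeftModule R.ring m ℓm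

    module Space n = LeftModule (space n)
    open module Space′ {n} = LeftModule (space n) public
      using (_≈ᴹ_; _+ᴹ_; _*ₗ_; 0ᴹ; -ᴹ_)

    Op : ℕ → Set m
    Op n = Space.Carrierᴹ n

    infixl 6 _-ᴹ_
    _-ᴹ_ : ∀ {n} → Op n → Op n → Op n
    x -ᴹ y = x +ᴹ (-ᴹ y)

    field
      𝟙 : Op 1
      compose : ∀ {m n k} → Op m → Fin m → Op n → .(suc k ≡ m + n) → Op k

      compose-linearˡ : ∀ {m n k} (i : Fin m) (y : Op n) .(e : suc k ≡ m + n) →
        IsLinear (space m) (space k) (λ x → compose x i y e)
      compose-linearʳ : ∀ {m n k} (x : Op m) (i : Fin m) .(e : suc k ≡ m + n) →
        IsLinear (space n) (space k) (λ y → compose x i y e)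

      identityˡ : ∀ {n} (x : Op n) → compose 𝟙 zero x refl ≈ᴹ x
      identityʳ : ∀ {n} (x : Op n) (i : Fin n) .(e : suc n ≡ n + 1) →
        compose x i 𝟙 e ≈ᴹ x

      sequential : ∀ {l m n lm mn lmn}
        (x : Op l) (y : Op m) (z : Op n) (i : Fin l) (j : Fin m) (i+j : Fin lm) →
        toℕ i+j ≡ toℕ i + toℕ j →
        .(e₁ : suc lm ≡ l + m) .(e₂ : suc lmn ≡ lm + n)
        .(e₃ : suc mn ≡ m + n) .(e₄ : suc lmn ≡ l + mn) →
        compose (compose x i y e₁) i+j z e₂ ≈ᴹ compose x i (compose y j z e₃) e₄

      -- The input k of x is the input k + m - 1 of x ∘ᵢ y when i < k.
      parallel : ∀ {l m n lm ln lmn}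
        (x : Op l) (y : Op m) (z : Op n) (i k : Fin l) (k′ : Fin lm) (i′ : Fin ln) →
        toℕ i < toℕ k → suc (toℕ k′) ≡ toℕ k + m → toℕ i′ ≡ toℕ i →
        .(e₁ : suc lm ≡ l + m) .(e₂ : suc lmn ≡ lm + n)
        .(e₃ : suc ln ≡ l + n) .(e₄ : suc lmn ≡ ln + m) →
        compose (compose x i y e₁) k′ z e₂ ≈ᴹ compose (compose x k z e₃) i′ y e₄

  record IsOperadIsomorphism (P : Operad m₁ ℓ₁) (Q : Operad m₂ ℓ₂)
                             (f : ∀ {n} → Operad.Op P n → Operad.Op Q n) :
                             Set (c ⊔ m₁ ⊔ ℓ₁ ⊔ m₂ ⊔ ℓ₂) where
    private
      module P = Operad P
      module Q = Operad Q
    field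
      linear-iso   : ∀ n → IsLinearIso (P.space n) (Q.space n) f
      𝟙-homo       : f P.𝟙 Q.≈ᴹ Q.𝟙
      compose-homo : ∀ {m n k} (x : P.Op m) (i : Fin m) (y : P.Op n) .(e : suc k ≡ m + n) →
        f (P.compose x i y e) Q.≈ᴹ Q.compose (f x) i (f y) e

module _ {R : CommutativeRing c ℓ} (P : Operad R m ℓm) where
  private module R = CommutativeRing R
  open Operad P

  data Ideal {d} (S : Pred (Op d) p) : ∀ {n} → Pred (Op n) (c ⊔ m ⊔ ℓm ⊔ p) where
    gen      : ∀ {x} → S x → Ideal S x
    0∈       : ∀ {n} → Ideal S (0ᴹ {n})
    +∈       : ∀ {n} {x y : Op n} → Ideal S x → Ideal S y → Ideal S (x +ᴹ y)
    *∈       : ∀ {n} r {x : Op n} → Ideal S x → Ideal S (r *ₗ x)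
    composeˡ : ∀ {m n k} {x : Op m} (i : Fin m) (y : Op n) .(e : suc k ≡ m + n) →
               Ideal S x → Ideal S (compose x i y e)
    composeʳ : ∀ {m n k} (x : Op m) (i : Fin m) {y : Op n} .(e : suc k ≡ m + n) →
               Ideal S y → Ideal S (compose x i y e)
    resp     : ∀ {n} {x y : Op n} → x ≈ᴹ y → Ideal S x → Ideal S y

  module _ {d} (S : Pred (Op d) p) where

    infix 4 _∼_
    _∼_ : ∀ {n} → Rel (Op n) (c ⊔ m ⊔ ℓm ⊔ p)
    x ∼ y = Ideal S (x -ᴹ y)

    private
      module _ {n : ℕ} where
        private module G = AbelianGroupProperties (LeftModule.+ᴹ-abelianGroup (space n))
        open LeftModule (space n) public using (≈ᴹ-refl; ≈ᴹ-sym; ≈ᴹ-trans;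
          +ᴹ-cong; +ᴹ-assoc; +ᴹ-comm; +ᴹ-identityˡ; +ᴹ-identityʳ; -ᴹ‿cong; -ᴹ‿inverse;
          *ₗ-zeroˡ; *ₗ-zeroʳ; *ₗ-identityˡ; *ₗ-assoc; *ₗ-congˡ; *ₗ-congʳ;
          *ₗ-distribˡ; *ₗ-distribʳ)

        ≈⇒∼ : {x y : Op n} → x ≈ᴹ y → x ∼ y
        ≈⇒∼ x≈y = resp (≈ᴹ-sym (G.x≈y⇒x∙y⁻¹≈ε x≈y)) 0∈

        neg-scale : (x : Op n) → ((R.- R.1#) *ₗ x) ≈ᴹ (-ᴹ x)
        neg-scale x = G.inverseʳ-unique x _
          (≈ᴹ-trans (+ᴹ-cong (≈ᴹ-sym (*ₗ-identityˡ x)) ≈ᴹ-refl)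
          (≈ᴹ-trans (≈ᴹ-sym (*ₗ-distribʳ x R.1# (R.- R.1#)))
          (≈ᴹ-trans (*ₗ-congʳ (R.-‿inverseʳ R.1#)) (*ₗ-zeroˡ x))))

        neg∈ : {x : Op n} → Ideal S x → Ideal S (-ᴹ x)
        neg∈ {x} x∈ = resp (neg-scale x) (*∈ (R.- R.1#) x∈)

        interchange : (x y u v : Op n) → ((x +ᴹ y) +ᴹ (u +ᴹ v)) ≈ᴹ ((x +ᴹ u) +ᴹ (y +ᴹ v))
        interchange x y u v =
          ≈ᴹ-trans (+ᴹ-assoc x y (u +ᴹ v))
          (≈ᴹ-trans (+ᴹ-cong ≈ᴹ-refl
            (≈ᴹ-trans (≈ᴹ-sym (+ᴹ-assoc y u v))
            (≈ᴹ-trans (+ᴹ-cong (+ᴹ-comm y u) ≈ᴹ-refl) (+ᴹ-assoc u y v))))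
          (≈ᴹ-sym (+ᴹ-assoc x u (y +ᴹ v))))

        ∼-sym : {x y : Op n} → x ∼ y → y ∼ x
        ∼-sym {x} {y} x∼y = resp (G.⁻¹-anti-homo‿- x y) (neg∈ x∼y)

        ∼-trans : {x y z : Op n} → x ∼ y → y ∼ z → x ∼ z
        ∼-trans {x} {y} {z} x∼y y∼z = resp
          (≈ᴹ-trans (+ᴹ-assoc x (-ᴹ y) (y -ᴹ z))
          (+ᴹ-cong ≈ᴹ-refl
            (≈ᴹ-trans (≈ᴹ-sym (+ᴹ-assoc (-ᴹ y) y (-ᴹ z)))
            (≈ᴹ-trans (+ᴹ-cong (proj₁ -ᴹ‿inverse y) ≈ᴹ-refl) (+ᴹ-identityˡ (-ᴹ z))))))
          (+∈ x∼y y∼z)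

        ∼-+ : {x y u v : Op n} → x ∼ y → u ∼ v → x +ᴹ u ∼ y +ᴹ v
        ∼-+ {x} {y} {u} {v} x∼y u∼v = resp
          (≈ᴹ-trans (interchange x (-ᴹ y) u (-ᴹ v)) (+ᴹ-cong ≈ᴹ-refl (G.⁻¹-∙-comm y v)))
          (+∈ x∼y u∼v)

      module _ {m n : ℕ} (f : Op m → Op n) (f-linear : IsLinear (space m) (space n) f)
               (f-ideal : ∀ {x} → Ideal S x → Ideal S (f x)) where
        private module f = Linear (space m) (space n) f-linear

        linear-∼ : ∀ {x y} → x ∼ y → f x ∼ f y
        linear-∼ {x} {y} x∼y = resp
          (≈ᴹ-trans (f.+ᴹ-homo x (-ᴹ y)) (+ᴹ-cong ≈ᴹ-refl (f.-ᴹ-homo y))) (f-ideal x∼y)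

      module _ (n : ℕ) (r : R.Carrier) where
        scale-linear : IsLinear (space n) (space n) (r *ₗ_)
        scale-linear = mkLinear (space n) (space n) (r *ₗ_) *ₗ-congˡ (*ₗ-distribˡ r)
          λ s x → ≈ᴹ-trans (≈ᴹ-sym (*ₗ-assoc r s x))
            (≈ᴹ-trans (*ₗ-congʳ (R.*-comm r s)) (*ₗ-assoc s r x))

        ∼-* : {x y : Op n} → x ∼ y → r *ₗ x ∼ r *ₗ y
        ∼-* = linear-∼ (r *ₗ_) scale-linear (*∈ r)

      ∼-neg : ∀ {n} {x y : Op n} → x ∼ y → (-ᴹ x) ∼ (-ᴹ y)
      ∼-neg {n} {x} {y} x∼y =
        ∼-trans (≈⇒∼ (≈ᴹ-sym (neg-scale x)))
        (∼-trans (∼-* n (R.- R.1#) x∼y) (≈⇒∼ (neg-scale y)))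

    quotientSpace : ℕ → LeftModule R.ring m (c ⊔ m ⊔ ℓm ⊔ p)
    quotientSpace n = record
      { Carrierᴹ = Op n
      ; _≈ᴹ_ = _∼_
      ; _+ᴹ_ = _+ᴹ_
      ; _*ₗ_ = _*ₗ_
      ; 0ᴹ = 0ᴹ
      ; -ᴹ_ = -ᴹ_
      ; isLeftModule = record
        { isLeftSemimodule = record
          { +ᴹ-isCommutativeMonoid = record
            { isMonoid = record
              { isSemigroup = record
                { isMagma = record
                  { isEquivalence = record
                    { refl = ≈⇒∼ ≈ᴹ-refl ; sym = ∼-sym ; trans = ∼-trans }
                  ; ∙-cong = ∼-+
                  }
                ; assoc = λ x y z → ≈⇒∼ (+ᴹ-assoc x y z)
                }
              ; identity = (λ x → ≈⇒∼ (+ᴹ-identityˡ x)) , (λ x → ≈⇒∼ (+ᴹ-identityʳ x))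
              }
            ; comm = λ x y → ≈⇒∼ (+ᴹ-comm x y)
            }
          ; isPreleftSemimodule = record
            { *ₗ-cong = λ {r} {s} {x} r≈s x∼y → ∼-trans (∼-* n r x∼y) (≈⇒∼ (*ₗ-congʳ r≈s))
            ; *ₗ-zeroˡ = λ x → ≈⇒∼ (*ₗ-zeroˡ x)
            ; *ₗ-distribʳ = λ x r s → ≈⇒∼ (*ₗ-distribʳ x r s)
            ; *ₗ-identityˡ = λ x → ≈⇒∼ (*ₗ-identityˡ x)
            ; *ₗ-assoc = λ r s x → ≈⇒∼ (*ₗ-assoc r s x)
            ; *ₗ-zeroʳ = λ r → ≈⇒∼ (*ₗ-zeroʳ r)
            ; *ₗ-distribˡ = λ r x y → ≈⇒∼ (*ₗ-distribˡ r x y)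
            }
          }
        ; -ᴹ‿cong = ∼-neg
        ; -ᴹ‿inverse = (λ x → ≈⇒∼ (proj₁ -ᴹ‿inverse x)) , (λ x → ≈⇒∼ (proj₂ -ᴹ‿inverse x))
        }
      }

    infixl 5 _/⟨_⟩
    _/⟨_⟩ : Operad R m (c ⊔ m ⊔ ℓm ⊔ p)
    _/⟨_⟩ = record
      { space = quotientSpace
      ; 𝟙 = 𝟙
      ; compose = compose
      ; compose-linearˡ = λ {m} {n} {k} i y e →
          let f = λ x → compose x i y e
              f-linear = compose-linearˡ i y e
              module f = Linear (space m) (space k) f-linear
          in mkLinear (quotientSpace m) (quotientSpace k) f
               (linear-∼ f f-linear (composeˡ i y e))
               (λ x x′ → ≈⇒∼ (f.+ᴹ-homo x x′)) (λ r x → ≈⇒∼ (f.*ₗ-homo r x))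
      ; compose-linearʳ = λ {m} {n} {k} x i e →
          let f = λ y → compose x i y e
              f-linear = compose-linearʳ x i e
              module f = Linear (space n) (space k) f-linear
          in mkLinear (quotientSpace n) (quotientSpace k) f
               (linear-∼ f f-linear (composeʳ x i e))
               (λ y y′ → ≈⇒∼ (f.+ᴹ-homo y y′)) (λ r y → ≈⇒∼ (f.*ₗ-homo r y))
      ; identityˡ = λ x → ≈⇒∼ (identityˡ x)
      ; identityʳ = λ x i e → ≈⇒∼ (identityʳ x i e)
      ; sequential = λ x y z i j i+j eq e₁ e₂ e₃ e₄ →
          ≈⇒∼ (sequential x y z i j i+j eq e₁ e₂ e₃ e₄)
      ; parallel = λ x y z i k k′ i′ i<k eq eq′ e₁ e₂ e₃ e₄ →
          ≈⇒∼ (parallel x y z i k k′ i′ i<k eq eq′ e₁ e₂ e₃ e₄)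
      }

data Tree (G : Set) : Set where
  leaf : Tree G
  node : G → Tree G → Tree G → Tree G

module _ {G : Set} where

  arity : Tree G → ℕ
  arity leaf         = 1
  arity (node _ l r) = arity l + arity r

  -- graft s i t replaces leaf number i of s, counted from 0, by t.
  graft : Tree G → ℕ → Tree G → Tree G
  graft leaf         i t = t
  graft (node x l r) i t with i ℕ.<? arity l
  ... | yes _ = node x (graft l i t) r
  ... | no  _ = node x l (graft r (i ∸ arity l) t)

  graft-left : ∀ x l r {i} t → i < arity l → graft (node x l r) i t ≡ node x (graft l i t) r
  graft-left x l r {i} t i<l with i ℕ.<? arity l
  ... | yes _   = refl
  ... | no  i≮l = contradiction i<l i≮l

  graft-right : ∀ x l r j t → graft (node x l r) (arity l + j) t ≡ node x l (graft r j t)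
  graft-right x l r j t with (arity l + j) ℕ.<? arity l
  ... | yes i<l = contradiction i<l (ℕ.m+n≮m (arity l) j)
  ... | no  _   = cong (λ k → node x l (graft r k t)) (ℕ.m+n∸m≡n (arity l) j)

  data Split (a : ℕ) : ℕ → Set where
    left  : ∀ {i} → i < a → Split a i
    right : ∀ j → Split a (a + j)

  split : ∀ a i → Split a i
  split a i with i ℕ.<? a
  ... | yes i<a = left i<a
  ... | no  i≮a = ≡.subst (Split a) (ℕ.m+[n∸m]≡n (ℕ.≮⇒≥ i≮a)) (right (i ∸ a))

  arity-graft : ∀ s i t → i < arity s → suc (arity (graft s i t)) ≡ arity s + arity t
  arity-graft leaf         i t i<s = refl
  arity-graft (node x l r) i t i<s with split (arity l) i
  ... | left i<l = begin
    suc (arity (graft (node x l r) i t))   ≡⟨ cong (λ u → suc (arity u)) (graft-left x l r t i<l) ⟩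
    suc (arity (graft l i t)) + arity r    ≡⟨ cong (_+ arity r) (arity-graft l i t i<l) ⟩
    arity l + arity t + arity r            ≡⟨ ℕ.+-assoc (arity l) _ _ ⟩
    arity l + (arity t + arity r)          ≡⟨ cong (arity l +_) (ℕ.+-comm (arity t) _) ⟩
    arity l + (arity r + arity t)          ≡⟨ ℕ.+-assoc (arity l) _ _ ⟨
    arity l + arity r + arity t            ∎
    where open ≡.≡-Reasoning
  ... | right j = begin
    suc (arity (graft (node x l r) (arity l + j) t)) ≡⟨ cong (λ u → suc (arity u)) (graft-right x l r j t) ⟩
    suc (arity l + arity (graft r j t))    ≡⟨ ℕ.+-suc (arity l) _ ⟨
    arity l + suc (arity (graft r j t))    ≡⟨ cong (arity l +_) (arity-graft r j t (ℕ.+-cancelˡ-< (arity l) _ _ i<s)) ⟩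
    arity l + (arity r + arity t)          ≡⟨ ℕ.+-assoc (arity l) _ _ ⟨
    arity l + arity r + arity t            ∎
    where open ≡.≡-Reasoning

  graft-leaf : ∀ s i → graft s i leaf ≡ s
  graft-leaf leaf         i = refl
  graft-leaf (node x l r) i with i ℕ.<? arity l
  ... | yes _ = cong (λ u → node x u r) (graft-leaf l i)
  ... | no  _ = cong (node x l) (graft-leaf r (i ∸ arity l))

  private
    graft-bound : ∀ s i t {j} → i < arity s → j < arity t → i + j < arity (graft s i t)
    graft-bound s i t {j} i<s j<t = ℕ.≤-pred (begin
      suc (suc (i + j))         ≡⟨ cong suc (ℕ.+-suc i j) ⟨
      suc i + suc j             ≤⟨ ℕ.+-mono-≤ i<s j<t ⟩
      arity s + arity t         ≡⟨ arity-graft s i t i<s ⟨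
      suc (arity (graft s i t)) ∎)
      where open ℕ.≤-Reasoning

  graft-sequential : ∀ s i t j u → i < arity s → j < arity t →
    graft (graft s i t) (i + j) u ≡ graft s i (graft t j u)
  graft-sequential leaf zero t j u _ _ = refl
  graft-sequential leaf (suc i) t j u (s≤s ()) _
  graft-sequential (node x l r) i t j u i<s j<t with split (arity l) i
  ... | left i<l = begin
    graft (graft (node x l r) i t) (i + j) u   ≡⟨ cong (λ v → graft v (i + j) u) (graft-left x l r t i<l) ⟩
    graft (node x (graft l i t) r) (i + j) u   ≡⟨ graft-left x (graft l i t) r u (graft-bound l i t i<l j<t) ⟩
    node x (graft (graft l i t) (i + j) u) r   ≡⟨ cong (λ v → node x v r) (graft-sequential l i t j u i<l j<t) ⟩
    node x (graft l i (graft t j u)) r         ≡⟨ graft-left x l r (graft t j u) i<l ⟨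
    graft (node x l r) i (graft t j u)         ∎
    where open ≡.≡-Reasoning
  ... | right k = begin
    graft (graft (node x l r) (arity l + k) t) (arity l + k + j) u
      ≡⟨ ≡.cong₂ (λ v o → graft v o u) (graft-right x l r k t) (ℕ.+-assoc (arity l) k j) ⟩
    graft (node x l (graft r k t)) (arity l + (k + j)) u
      ≡⟨ graft-right x l (graft r k t) (k + j) u ⟩
    node x l (graft (graft r k t) (k + j) u)
      ≡⟨ cong (node x l) (graft-sequential r k t j u (ℕ.+-cancelˡ-< (arity l) _ _ i<s) j<t) ⟩
    node x l (graft r k (graft t j u))
      ≡⟨ graft-right x l r k (graft t j u) ⟨
    graft (node x l r) (arity l + k) (graft t j u) ∎
    where open ≡.≡-Reasoning

  graft-parallel : ∀ s i t k u k′ → i < k → k < arity s → suc k′ ≡ k + arity t →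
    graft (graft s i t) k′ u ≡ graft (graft s k u) i t
  graft-parallel leaf i t (suc k) u k′ _ (s≤s ()) _
  graft-parallel (node x l r) i t k u k′ i<k k<s eq with split (arity l) k | split (arity l) i
  ... | left k<l | left i<l = begin
    graft (graft (node x l r) i t) k′ u   ≡⟨ cong (λ v → graft v k′ u) (graft-left x l r t i<l) ⟩
    graft (node x (graft l i t) r) k′ u   ≡⟨ graft-left x (graft l i t) r u k′< ⟩
    node x (graft (graft l i t) k′ u) r   ≡⟨ cong (λ v → node x v r) (graft-parallel l i t k u k′ i<k k<l eq) ⟩
    node x (graft (graft l k u) i t) r    ≡⟨ graft-left x (graft l k u) r t i< ⟨
    graft (node x (graft l k u) r) i t    ≡⟨ cong (λ v → graft v i t) (graft-left x l r u k<l) ⟨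
    graft (graft (node x l r) k u) i t    ∎
    where
    open ≡.≡-Reasoning
    k′< : k′ < arity (graft l i t)
    k′< = ℕ.≤-pred (ℕ.≤-trans (ℕ.≤-reflexive (cong suc eq))
      (ℕ.≤-trans (ℕ.+-monoˡ-≤ (arity t) k<l) (ℕ.≤-reflexive (≡.sym (arity-graft l i t i<l)))))
    i< : i < arity (graft l k u)
    i< = ℕ.≤-pred (ℕ.≤-trans (s≤s i<k) (ℕ.≤-trans k<l
      (ℕ.≤-trans (ℕ.m≤m+n (arity l) (arity u)) (ℕ.≤-reflexive (≡.sym (arity-graft l k u k<l))))))
  ... | left k<l | right j = contradiction (ℕ.<-trans i<k k<l) (ℕ.m+n≮m (arity l) j)
  ... | right k₁ | left i<l = begin
    graft (graft (node x l r) i t) k′ u    ≡⟨ ≡.cong₂ (λ v o → graft v o u) (graft-left x l r t i<l) k′≡ ⟩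
    graft (node x (graft l i t) r) (arity (graft l i t) + k₁) u
                                           ≡⟨ graft-right x (graft l i t) r k₁ u ⟩
    node x (graft l i t) (graft r k₁ u)    ≡⟨ graft-left x l (graft r k₁ u) t i<l ⟨
    graft (node x l (graft r k₁ u)) i t    ≡⟨ cong (λ v → graft v i t) (graft-right x l r k₁ u) ⟨
    graft (graft (node x l r) (arity l + k₁) u) i t ∎
    where
    open ≡.≡-Reasoning
    k′≡ : k′ ≡ arity (graft l i t) + k₁
    k′≡ = ℕ.suc-injective (begin
      suc k′                          ≡⟨ eq ⟩
      arity l + k₁ + arity t          ≡⟨ ℕ.+-assoc (arity l) _ _ ⟩
      arity l + (k₁ + arity t)        ≡⟨ cong (arity l +_) (ℕ.+-comm k₁ _) ⟩
      arity l + (arity t + k₁)        ≡⟨ ℕ.+-assoc (arity l) _ _ ⟨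
      arity l + arity t + k₁          ≡⟨ cong (_+ k₁) (arity-graft l i t i<l) ⟨
      suc (arity (graft l i t)) + k₁  ∎)
  ... | right k₁ | right i₁ with k₁ | ℕ.+-cancelˡ-< (arity l) _ _ i<k
  ...   | suc k₂ | i₁<k₁ = begin
    graft (graft (node x l r) (arity l + i₁) t) k′ u
      ≡⟨ ≡.cong₂ (λ v o → graft v o u) (graft-right x l r i₁ t) k′≡ ⟩
    graft (node x l (graft r i₁ t)) (arity l + (k₂ + arity t)) u
      ≡⟨ graft-right x l (graft r i₁ t) (k₂ + arity t) u ⟩
    node x l (graft (graft r i₁ t) (k₂ + arity t) u)
      ≡⟨ cong (node x l) (graft-parallel r i₁ t (suc k₂) u (k₂ + arity t) i₁<k₁
           (ℕ.+-cancelˡ-< (arity l) _ _ k<s) refl) ⟩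
    node x l (graft (graft r (suc k₂) u) i₁ t)
      ≡⟨ graft-right x l (graft r (suc k₂) u) i₁ t ⟨
    graft (node x l (graft r (suc k₂) u)) (arity l + i₁) t
      ≡⟨ cong (λ v → graft v (arity l + i₁) t) (graft-right x l r (suc k₂) u) ⟨
    graft (graft (node x l r) (arity l + suc k₂) u) (arity l + i₁) t ∎
    where
    open ≡.≡-Reasoning
    k′≡ : k′ ≡ arity l + (k₂ + arity t)
    k′≡ = ℕ.suc-injective (≡.trans eq
      (≡.trans (ℕ.+-assoc (arity l) (suc k₂) _) (ℕ.+-suc (arity l) _)))

record TreeOfArity (G : Set) (n : ℕ) : Set where
  constructor _,_
  field
    tree     : Tree G
    .arity-≡ : arity tree ≡ n

open TreeOfArity public using (tree)

module _ {G : Set} where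

  tree-injective : ∀ {n} {s t : TreeOfArity G n} → tree s ≡ tree t → s ≡ t
  tree-injective refl = refl

  arity-tree : ∀ {n} (s : TreeOfArity G n) → arity (tree s) ≡ n
  arity-tree {n} (s , e) = recompute (arity s ℕ.≟ n) e

  toℕ<arity : ∀ {n} (s : TreeOfArity G n) (i : Fin n) → toℕ i < arity (tree s)
  toℕ<arity s i = ≡.subst (toℕ i <_) (≡.sym (arity-tree s)) (Fin.toℕ<n i)

  graftAt : ∀ {m n k} → TreeOfArity G m → Fin m → TreeOfArity G n → .(suc k ≡ m + n) → TreeOfArity G k
  graftAt s i t e = graft (tree s) (toℕ i) (tree t) , ℕ.suc-injective (≡.trans
    (arity-graft (tree s) (toℕ i) (tree t) (toℕ<arity s i))
    (≡.trans (≡.cong₂ _+_ (arity-tree s) (arity-tree t)) (≡.sym e)))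

module _ (R : CommutativeRing c ℓ) (G : Set) where
  private
    module R = CommutativeRing R

    space : ℕ → LeftModule R.ring c (c ⊔ ℓ)
    space n = FreeModule R.ring (TreeOfArity G n)

    Op : ℕ → Set c
    Op n = LeftModule.Carrierᴹ (space n)

    _≈_ : ∀ {n} → Rel (Op n) (c ⊔ ℓ)
    _≈_ {n} = LeftModule._≈ᴹ_ (space n)

    𝟙 : Op 1
    𝟙 = var (leaf , refl)

    compose : ∀ {m n k} → Op m → Fin m → Op n → .(suc k ≡ m + n) → Op k
    compose {k = k} x i y e =
      extend (space k) (λ s → extend (space k) (λ t → var (graftAt s i t e)) y) x

    linearˡ : ∀ {m n k} (i : Fin m) (y : Op n) .(e : suc k ≡ m + n) →
              IsLinear (space m) (space k) (λ x → compose x i y e)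
    linearˡ {k = k} i y e = extend-linear (space k) _

    linearʳ : ∀ {m n k} (x : Op m) (i : Fin m) .(e : suc k ≡ m + n) →
              IsLinear (space n) (space k) (λ y → compose x i y e)
    linearʳ {m} {n} {k} x i e = mkLinear (space n) (space k) _ (⟦⟧-cong x) (+-homo x) (*-homo x)
      where
      open LeftModule (space k)

      ⟦⟧-cong : ∀ x {y z} → y ≈ z → compose x i y e ≈ compose x i z e
      ⟦⟧-cong (var s)  y≈z = extend-cong (space k) _ y≈z
      ⟦⟧-cong 𝟎        y≈z = ≈ᴹ-refl
      ⟦⟧-cong (x ⊕ x′) y≈z = +ᴹ-cong (⟦⟧-cong x y≈z) (⟦⟧-cong x′ y≈z)
      ⟦⟧-cong (r ⊛ x)  y≈z = *ₗ-congˡ (⟦⟧-cong x y≈z)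

      +-homo : ∀ x y z → compose x i (y ⊕ z) e ≈ (compose x i y e ⊕ compose x i z e)
      +-homo (var s)  y z = ≈ᴹ-refl
      +-homo 𝟎        y z = ≈ᴹ-sym (+ᴹ-identityˡ 𝟎)
      +-homo (x ⊕ x′) y z =
        ≈ᴹ-trans (+ᴹ-cong (+-homo x y z) (+-homo x′ y z))
        (≈ᴹ-trans (+ᴹ-assoc _ _ _)
        (≈ᴹ-trans (+ᴹ-congˡ
          (≈ᴹ-trans (≈ᴹ-sym (+ᴹ-assoc _ _ _))
          (≈ᴹ-trans (+ᴹ-congʳ (+ᴹ-comm _ _)) (+ᴹ-assoc _ _ _))))
        (≈ᴹ-sym (+ᴹ-assoc _ _ _))))
      +-homo (r ⊛ x)  y z = ≈ᴹ-trans (*ₗ-congˡ (+-homo x y z)) (*ₗ-distribˡ r _ _)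

      *-homo : ∀ x r y → compose x i (r ⊛ y) e ≈ (r ⊛ compose x i y e)
      *-homo (var s)  r y = ≈ᴹ-refl
      *-homo 𝟎        r y = ≈ᴹ-sym (*ₗ-zeroʳ r)
      *-homo (x ⊕ x′) r y =
        ≈ᴹ-trans (+ᴹ-cong (*-homo x r y) (*-homo x′ r y)) (≈ᴹ-sym (*ₗ-distribˡ r _ _))
      *-homo (q ⊛ x)  r y =
        ≈ᴹ-trans (*ₗ-congˡ (*-homo x r y))
        (≈ᴹ-trans (≈ᴹ-sym (*ₗ-assoc q r _))
        (≈ᴹ-trans (*ₗ-congʳ (R.*-comm q r)) (*ₗ-assoc r q _)))

    var-cong : ∀ {n} {s t : TreeOfArity G n} → tree s ≡ tree t → var s ≈ var t
    var-cong {n} {s} eq = LeftModule.≈ᴹ-reflexive (space n) (cong var (tree-injective eq))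

    id-linear : ∀ n → IsLinear (space n) (space n) (λ x → x)
    id-linear n = mkLinear (space n) (space n) (λ x → x) (λ e → e)
      (λ _ _ → LeftModule.≈ᴹ-refl (space n)) (λ _ _ → LeftModule.≈ᴹ-refl (space n))

  Free : Operad R c (c ⊔ ℓ)
  Free = record
    { space = space
    ; 𝟙 = 𝟙
    ; compose = compose
    ; compose-linearˡ = linearˡ
    ; compose-linearʳ = linearʳ
    ; identityˡ = λ {n} → linear-ext (space n) (linearʳ 𝟙 zero refl) (id-linear n) λ t → ≋-refl
    ; identityʳ = λ {n} x i e → linear-ext (space n) (linearˡ i 𝟙 e) (id-linear n)
        (λ s → var-cong (graft-leaf (tree s) (toℕ i))) x
    ; sequential = sequential
    ; parallel = parallel
    }
    where
    _⊚_ : ∀ {l m n} {g : Op m → Op n} {f : Op l → Op m} →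
          IsLinear (space m) (space n) g → IsLinear (space l) (space m) f →
          IsLinear (space l) (space n) (λ x → g (f x))
    _⊚_ {n = n} g-linear f-linear =
      Composition.isLeftModuleHomomorphism (LeftModule.≈ᴹ-trans (space n)) f-linear g-linear

    sequential : ∀ {l m n lm mn lmn}
      (x : Op l) (y : Op m) (z : Op n) (i : Fin l) (j : Fin m) (i+j : Fin lm) →
      toℕ i+j ≡ toℕ i + toℕ j →
      .(e₁ : suc lm ≡ l + m) .(e₂ : suc lmn ≡ lm + n)
      .(e₃ : suc mn ≡ m + n) .(e₄ : suc lmn ≡ l + mn) →
      compose (compose x i y e₁) i+j z e₂ ≈ compose x i (compose y j z e₃) e₄
    sequential {l} {m} {n} {lm} {mn} {lmn} x y z i j i+j eq e₁ e₂ e₃ e₄ =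
      linear-ext M (linearˡ i+j z e₂ ⊚ linearˡ i y e₁) (linearˡ i (compose y j z e₃) e₄)
        (λ s → linear-ext M (linearˡ i+j z e₂ ⊚ linearʳ (var s) i e₁)
                            (linearʳ (var s) i e₄ ⊚ linearˡ j z e₃)
          (λ t → linear-ext M (linearʳ (var (graftAt s i t e₁)) i+j e₂)
                              (linearʳ (var s) i e₄ ⊚ linearʳ (var t) j e₃)
            (λ u → var-cong (≡.trans
              (cong (λ o → graft (graft (tree s) (toℕ i) (tree t)) o (tree u)) eq)
              (graft-sequential (tree s) (toℕ i) (tree t) (toℕ j) (tree u) (toℕ<arity s i) (toℕ<arity t j))))
            z) y) x
      where M = space lmn

    parallel : ∀ {l m n lm ln lmn}
      (x : Op l) (y : Op m) (z : Op n) (i k : Fin l) (k′ : Fin lm) (i′ : Fin ln) →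
      toℕ i < toℕ k → suc (toℕ k′) ≡ toℕ k + m → toℕ i′ ≡ toℕ i →
      .(e₁ : suc lm ≡ l + m) .(e₂ : suc lmn ≡ lm + n)
      .(e₃ : suc ln ≡ l + n) .(e₄ : suc lmn ≡ ln + m) →
      compose (compose x i y e₁) k′ z e₂ ≈ compose (compose x k z e₃) i′ y e₄
    parallel {lmn = lmn} x y z i k k′ i′ i<k eq eq′ e₁ e₂ e₃ e₄ =
      linear-ext M (linearˡ k′ z e₂ ⊚ linearˡ i y e₁) (linearˡ i′ y e₄ ⊚ linearˡ k z e₃)
        (λ s → linear-ext M (linearˡ k′ z e₂ ⊚ linearʳ (var s) i e₁)
                            (linearʳ (compose (var s) k z e₃) i′ e₄)
          (λ t → linear-ext M (linearʳ (var (graftAt s i t e₁)) k′ e₂)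
                              (linearˡ i′ (var t) e₄ ⊚ linearʳ (var s) k e₃)
            (λ u → var-cong (≡.trans
              (graft-parallel (tree s) (toℕ i) (tree t) (toℕ k) (tree u) (toℕ k′) i<k (toℕ<arity s k)
                (≡.trans eq (cong (toℕ k +_) (≡.sym (arity-tree t)))))
              (cong (λ o → graft (graft (tree s) (toℕ k) (tree u)) o (tree t)) (≡.sym eq′))))
            z) y) x
      where M = space lmn

module _ (R : CommutativeRing c ℓ) {G : Set} where
  open Operad (Free R G)

  generator : G → Op 2
  generator x = var (node x leaf leaf , refl)

  infixl 7 _∘₁_ _∘₂_
  _∘₁_ _∘₂_ : Op 2 → Op 2 → Op 3
  f ∘₁ g = compose f zero g refl
  f ∘₂ g = compose f (suc zero) g refl

  module _ (_≟_ : DecidableEquality G) where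
    open CommutativeRing R using (Carrier; 0#; 1#; -_; ring)

    -- The first two clauses are the pairs (x ∘₁ y , x′ ∘₁ y′) and
    -- (x ∘₂ y , x′ ∘₂ y′); every tree with three leaves is of the form
    -- x ∘₁ y or x ∘₂ y.
    treeForm : Tree G → Tree G → Carrier
    treeForm (node x (node y leaf leaf) leaf) (node x′ (node y′ leaf leaf) leaf) =
      if does (x ≟ x′) ∧ does (y ≟ y′) then 1# else 0#
    treeForm (node x leaf (node y leaf leaf)) (node x′ leaf (node y′ leaf leaf)) =
      if does (x ≟ x′) ∧ does (y ≟ y′) then - 1# else 0#
    treeForm _ _ = 0#

    form : Op 3 → Op 3 → Carrier
    form f g = extend K (λ s → extend K (λ t → treeForm (tree s) (tree t)) g) f
      where K = regularModule {R = ring}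

    Annihilator : Pred (Op 3) p → Pred (Op 3) (c ⊔ ℓ ⊔ p)
    Annihilator S f = ∀ g → S g → form g f ≈ 0#
      where open CommutativeRing R using (_≈_)

record Presentation (R : CommutativeRing c ℓ) p : Set (c ⊔ lsuc p) where
  field
    Generator : Set
    _≟_       : DecidableEquality Generator
    Relation  : Pred (Operad.Op (Free R Generator) 3) p

module _ {R : CommutativeRing c ℓ} where

  Presented : Presentation R p → Operad R c (c ⊔ ℓ ⊔ p)
  Presented P = Free R Generator /⟨ Relation ⟩
    where open Presentation P

  koszulDual : Presentation R p → Presentation R (c ⊔ ℓ ⊔ p)
  koszulDual P = record
    { Generator = Generator
    ; _≟_       = _≟_
    ; Relation  = Annihilator R _≟_ Relation
    }
    where open Presentation P

  record Presents (P : Presentation R p) (O : Operad R m ℓm)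
                  (element : Presentation.Generator P → Operad.Op O 2) :
                  Set (c ⊔ ℓ ⊔ m ⊔ ℓm ⊔ p) where
    open Operad O using (Op; _≈ᴹ_)
    field
      to            : ∀ {n} → Operad.Op (Presented P) n → Op n
      isIsomorphism : IsOperadIsomorphism R (Presented P) O to
      to-generator  : ∀ x → to (generator R x) ≈ᴹ element x

module _ (K : HeytingField c ℓ₁ ℓ₂) where

  scalars : CommutativeRing c ℓ₁
  scalars = HeytingCommutativeRing.commutativeRing (HeytingField.heytingCommutativeRing K)

  CharacteristicZero : Set ℓ₁
  CharacteristicZero = ∀ n → n × 1# ≈ 0# → n ≡ 0
    where
    open CommutativeRing scalars using (_≈_; 0#; 1#; +-rawMonoid)
    open RawMonoidDefinitions +-rawMonoid using (_×_)

  -- Fin γ stands for [γ]: the index a of the mathematics is suc (toℕ a).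
  module _ (γ : ℕ) where
    open Operad (Free scalars (Fin γ)) using (Op; _-ᴹ_; _+ᴹ_; 0ᴹ)
    open Max (Fin.≤-totalOrder γ) using () renaming (_⊔_ to _↑_)

    private
      _∘₁′_ _∘₂′_ : Op 2 → Op 2 → Op 3
      _∘₁′_ = _∘₁_ scalars
      _∘₂′_ = _∘₂_ scalars

      ⋆ ◇ : Fin γ → Op 2
      ⋆ = generator scalars
      ◇ = generator scalars

    data AsRelator : Pred (Op 3) 0ℓ where
      rel₁ : ∀ a a′ → AsRelator ((⋆ a ∘₁′ ⋆ a′) -ᴹ (⋆ (a ↑ a′) ∘₂′ ⋆ (a ↑ a′)))
      rel₂ : ∀ a a′ → AsRelator ((⋆ a ∘₂′ ⋆ a′) -ᴹ (⋆ (a ↑ a′) ∘₂′ ⋆ (a ↑ a′)))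

    AsPresentation : Presentation scalars (c ⊔ ℓ₁)
    AsPresentation = record
      { Generator = Fin γ
      ; _≟_       = Fin._≟_
      ; Relation  = Span (Operad.space (Free scalars (Fin γ)) 3) AsRelator
      }

    DAs : Operad scalars c (c ⊔ ℓ₁)
    DAs = Presented (koszulDual AsPresentation)

    lozenge : Fin γ → Operad.Op DAs 2
    lozenge = generator scalars

    diamond : Fin γ → Operad.Op DAs 2
    diamond b = foldr _+ᴹ_ 0ᴹ (map lozenge (filter (Fin._≤? b) (allFin γ)))

    -- Here the generators are formal symbols ◇ b, which Presents matches
    -- with the elements diamond b of DAs.
    data DiamondRelator : Pred (Op 3) 0ℓ where
      rel : ∀ a → DiamondRelator ((◇ a ∘₁′ ◇ a) -ᴹ (◇ a ∘₂′ ◇ a))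

    DiamondPresentation : Presentation scalars (c ⊔ ℓ₁)
    DiamondPresentation = record
      { Generator = Fin γ
      ; _≟_       = Fin._≟_
      ; Relation  = Span (Operad.space (Free scalars (Fin γ)) 3) DiamondRelator
      }

{-# OPTIONS --safe #-}
-- With w(x,y) = ◇x ∘₁ ◇y − ◇x ∘₂ ◇y, pairing an element of arity 3 with the relators
-- of As shows that the annihilator consists of the sums
--   N(d) = Σ_{x,y} d(max(x,y)) w(x,y),  d an arbitrary function on [γ].
-- Let ζ b be the indicator function of [b].  Since ζ b x · ζ b y = ζ b (max(x,y)),
-- bilinearity gives ◆b ∘₁ ◆b − ◆b ∘₂ ◆b = N(ζ b) for ◆b = Σ_x ζ b x ◇x.  The matrix ζ
-- is invertible, with inverse μ, so every d is a linear combination of the ζ b and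
-- these elements span the annihilator.  The maps Φ (◆b ↦ Σ_x ζ b x ◇x) and
-- Ψ (◇x ↦ Σ_b μ x b ◆b) are mutually inverse on the free operads.
module Submission where

open import Defs
open import Algebra.Apartness.Bundles using (HeytingField)
open import Algebra.Bundles using (AbelianGroup; CommutativeMonoid; CommutativeRing)
import Algebra.Construct.NaturalChoice.Max as Max
open import Algebra.Module.Bundles using (LeftModule)
open import Algebra.Module.Construct.TensorUnit using () renaming (leftModule to regularModule)
import Algebra.Module.Morphism.Construct.Composition as Composition
import Algebra.Properties.AbelianGroup as AbelianGroupProperties
import Algebra.Properties.CommutativeMonoid.Sum as CommutativeMonoidSum
import Algebra.Properties.CommutativeSemigroup as CommutativeSemigroupProperties
import Algebra.Properties.Ring as RingProperties
import Algebra.Properties.Semiring.Sum as SemiringSum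
open import Data.Bool.Base using (true; false; if_then_else_; _∧_)
open import Data.Fin.Base using (Fin; zero; suc; toℕ; fromℕ<; _≤_)
import Data.Fin.Properties as Fin
open import Data.List.Base using (allFin; filter; foldr; map; tabulate)
open import Data.Nat.Base using (ℕ; zero; suc; _+_; _<_; s≤s; z≤n)
import Data.Nat.Properties as ℕ
open import Data.Product.Base using (_,_)
open import Level using (Level; _⊔_; 0ℓ)
import Relation.Binary.Reasoning.Setoid as SetoidReasoning
open import Relation.Binary.PropositionalEquality as ≡ using (_≡_; refl; cong)
open import Relation.Nullary using (yes; no; does; ¬_; Dec; contradiction; recompute)
open import Relation.Unary using (Pred; Decidable)

private
  variable
    m m₁ m₂ m₃ ℓ₁ ℓ₂ ℓ₃ ℓm p q : Level

-- Binary trees with three leaves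

data Arity3 {G : Set} : Tree G → Set where
  leftComb  : ∀ x y → Arity3 (node x (node y leaf leaf) leaf)
  rightComb : ∀ x y → Arity3 (node x leaf (node y leaf leaf))

module _ {G : Set} where

  internal : Tree G → ℕ
  internal leaf         = 0
  internal (node _ l r) = suc (internal l + internal r)

  arity-internal : ∀ t → arity t ≡ suc (internal t)
  arity-internal leaf         = refl
  arity-internal (node _ l r) = ≡.trans (≡.cong₂ _+_ (arity-internal l) (arity-internal r))
    (cong suc (ℕ.+-suc (internal l) (internal r)))

  -- A binary tree has one leaf more than it has internal nodes, so three leaves leave exactly one
  -- node below the root, as its left or its right child.
  arity3 : ∀ t → arity t ≡ 3 → Arity3 t
  arity3 t e = comb t (ℕ.suc-injective (≡.trans (≡.sym (arity-internal t)) e))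
    where
    -- Counting internal nodes instead of leaves puts every `suc` in constructor position, so the
    -- shapes with too many nodes are refuted by matching.
    comb : ∀ t → internal t ≡ 2 → Arity3 t
    comb (node x leaf (node y leaf leaf))                   _ = rightComb x y
    comb (node x (node y leaf leaf) leaf)                   _ = leftComb x y
    comb (node x leaf (node y (node _ _ _) r))              ()
    comb (node x leaf (node y leaf (node _ _ _)))           ()
    comb (node x (node y leaf leaf) (node _ _ _))           ()
    comb (node x (node y leaf (node _ _ _)) r)              ()
    comb (node x (node y (node _ _ _) _) r)                 ()

module OverCommutativeRing {c ℓ} (R : CommutativeRing c ℓ) where

  private
    module R = CommutativeRing R
    module RS = SemiringSum R.semiring
  open R using (Carrier; ring; 0#; 1#)

  -- Linear maps and operad homomorphisms

  ∘-linear : {L : LeftModule ring m₁ ℓ₁} {M : LeftModule ring m₂ ℓ₂} {N : LeftModule ring m₃ ℓ₃}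
             {g : LeftModule.Carrierᴹ M → LeftModule.Carrierᴹ N}
             {f : LeftModule.Carrierᴹ L → LeftModule.Carrierᴹ M} →
             IsLinear M N g → IsLinear L M f → IsLinear L N (λ x → g (f x))
  ∘-linear {N = N} g-linear f-linear =
    Composition.isLeftModuleHomomorphism (LeftModule.≈ᴹ-trans N) f-linear g-linear

  id-linear : (M : LeftModule ring m₁ ℓ₁) → IsLinear M M (λ x → x)
  id-linear M = mkLinear M M (λ x → x) (λ e → e) (λ _ _ → M.≈ᴹ-refl) (λ _ _ → M.≈ᴹ-refl)
    where module M = LeftModule M

  record IsOperadHomomorphism (P : Operad R m₁ ℓ₁) (Q : Operad R m₂ ℓ₂)
                              (f : ∀ {n} → Operad.Op P n → Operad.Op Q n) :
                              Set (c ⊔ m₁ ⊔ ℓ₁ ⊔ m₂ ⊔ ℓ₂) where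
    private
      module P = Operad P
      module Q = Operad Q
    field
      linear       : ∀ n → IsLinear (P.space n) (Q.space n) f
      𝟙-homo       : f P.𝟙 Q.≈ᴹ Q.𝟙
      compose-homo : ∀ {m n k} (x : P.Op m) (i : Fin m) (y : P.Op n) .(e : suc k ≡ m + n) →
        f (P.compose x i y e) Q.≈ᴹ Q.compose (f x) i (f y) e

    module _ {n : ℕ} where
      open Linear (P.space n) (Q.space n) (linear n) public
        using (⟦⟧-cong; +ᴹ-homo; *ₗ-homo; 0ᴹ-homo; -ᴹ-homo)

  id-homomorphism : (P : Operad R m₁ ℓ₁) → IsOperadHomomorphism P P (λ x → x)
  id-homomorphism P = record
    { linear       = λ n → id-linear (space n)
    ; 𝟙-homo       = LeftModule.≈ᴹ-refl (space 1)
    ; compose-homo = λ {k = k} _ _ _ _ → LeftModule.≈ᴹ-refl (space k)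
    }
    where open Operad P

  ∘-homomorphism : {P : Operad R m₁ ℓ₁} {Q : Operad R m₂ ℓ₂} {O : Operad R m₃ ℓ₃}
                   {g : ∀ {n} → Operad.Op Q n → Operad.Op O n}
                   {f : ∀ {n} → Operad.Op P n → Operad.Op Q n} →
                   IsOperadHomomorphism Q O g → IsOperadHomomorphism P Q f →
                   IsOperadHomomorphism P O (λ x → g (f x))
  ∘-homomorphism {P = P} {Q} {O} {g} {f} g-hom f-hom = record
    { linear       = λ n → ∘-linear {L = Operad.space P n} {Operad.space Q n} {Operad.space O n}
                             (g.linear n) (f.linear n)
    ; 𝟙-homo       = LeftModule.≈ᴹ-trans (Operad.space O 1) (g.⟦⟧-cong f.𝟙-homo) g.𝟙-homo
    ; compose-homo = λ {k = k} x i y e → LeftModule.≈ᴹ-trans (Operad.space O k)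
        (g.⟦⟧-cong (f.compose-homo x i y e)) (g.compose-homo (f x) i (f y) e)
    }
    where
    module f = IsOperadHomomorphism f-hom
    module g = IsOperadHomomorphism g-hom

  -- Ideals and isomorphisms of quotients

  module _ {P : Operad R m₁ ℓ₁} {Q : Operad R m₂ ℓ₂}
           {f : ∀ {n} → Operad.Op P n → Operad.Op Q n} (f-hom : IsOperadHomomorphism P Q f) where
    private
      module P = Operad P
      module Q = Operad Q
      module Q-space {n} = LeftModule (Q.space n)
      open IsOperadHomomorphism f-hom

    -- The preimage of an ideal under an operad homomorphism is again an ideal, so only the
    -- generators in `S` have to be checked.
    map-Ideal : ∀ {d} {S : Pred (P.Op d) p} {T : Pred (Q.Op d) q} →
                (∀ {x} → S x → Ideal Q T (f x)) →
                ∀ {n} {x : P.Op n} → Ideal P S x → Ideal Q T (f x)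
    map-Ideal S⇒T (gen x∈)         = S⇒T x∈
    map-Ideal S⇒T 0∈               = resp (Q-space.≈ᴹ-sym 0ᴹ-homo) 0∈
    map-Ideal S⇒T (+∈ x∈ y∈)       = resp (Q-space.≈ᴹ-sym (+ᴹ-homo _ _))
      (+∈ (map-Ideal S⇒T x∈) (map-Ideal S⇒T y∈))
    map-Ideal S⇒T (*∈ r x∈)        = resp (Q-space.≈ᴹ-sym (*ₗ-homo r _)) (*∈ r (map-Ideal S⇒T x∈))
    map-Ideal S⇒T (composeˡ i y e x∈) = resp (Q-space.≈ᴹ-sym (compose-homo _ i y e))
      (composeˡ i (f y) e (map-Ideal S⇒T x∈))
    map-Ideal S⇒T (composeʳ x i e y∈) = resp (Q-space.≈ᴹ-sym (compose-homo x i _ e))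
      (composeʳ (f x) i e (map-Ideal S⇒T y∈))
    map-Ideal S⇒T (resp x≈y x∈)    = resp (⟦⟧-cong x≈y) (map-Ideal S⇒T x∈)

  ≈⇒∼ : (P : Operad R m₁ ℓ₁) → ∀ {d} (S : Pred (Operad.Op P d) p) {n} {x y : Operad.Op P n} →
        Operad._≈ᴹ_ P x y → _∼_ P S x y
  ≈⇒∼ P S {n} x≈y = resp (LeftModule.≈ᴹ-sym (Operad.space P n) (x≈y⇒x∙y⁻¹≈ε x≈y)) 0∈
    where open AbelianGroupProperties (LeftModule.+ᴹ-abelianGroup (Operad.space P n))

  module _ {P : Operad R m₁ ℓ₁} {Q : Operad R m₂ ℓ₂}
           {f : ∀ {n} → Operad.Op P n → Operad.Op Q n} {g : ∀ {n} → Operad.Op Q n → Operad.Op P n}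
           (f-hom : IsOperadHomomorphism P Q f) (g-hom : IsOperadHomomorphism Q P g)
           (g∘f : ∀ {n} (x : Operad.Op P n) → Operad._≈ᴹ_ P (g (f x)) x)
           (f∘g : ∀ {n} (y : Operad.Op Q n) → Operad._≈ᴹ_ Q (f (g y)) y)
           {d} {S : Pred (Operad.Op P d) p} {T : Pred (Operad.Op Q d) q}
           (S⇒T : ∀ {x} → S x → Ideal Q T (f x)) (T⇒S : ∀ {y} → T y → Ideal P S (g y))
           where
    private
      module P = Operad P
      module Q = Operad Q
      module f = IsOperadHomomorphism f-hom
      module g = IsOperadHomomorphism g-hom
      module Q/T {n} = LeftModule (Operad.space (Q /⟨ T ⟩) n)
      module P/S {n} = LeftModule (Operad.space (P /⟨ S ⟩) n)

      f-∼ : ∀ {n} {x y : P.Op n} → _∼_ P S x y → _∼_ Q T (f x) (f y)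
      f-∼ {n} x∼y = resp
        (LeftModule.≈ᴹ-trans (Q.space n) (f.+ᴹ-homo _ _)
          (LeftModule.+ᴹ-congˡ (Q.space n) (f.-ᴹ-homo _)))
        (map-Ideal f-hom S⇒T x∼y)

      g-∼ : ∀ {n} {x y : Q.Op n} → _∼_ Q T x y → _∼_ P S (g x) (g y)
      g-∼ {n} x∼y = resp
        (LeftModule.≈ᴹ-trans (P.space n) (g.+ᴹ-homo _ _)
          (LeftModule.+ᴹ-congˡ (P.space n) (g.-ᴹ-homo _)))
        (map-Ideal g-hom T⇒S x∼y)

    -- Each map sends the generating relations of its source into the ideal of its target, so both
    -- descend to the quotients. Injectivity follows by applying `g`, and `g y` is a preimage of
    -- `y`.
    quotient-isomorphism : IsOperadIsomorphism R (P /⟨ S ⟩) (Q /⟨ T ⟩) f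
    quotient-isomorphism = record
      { linear-iso = λ n → record
        { isLeftModuleMonomorphism = record
          { isLeftModuleHomomorphism = mkLinear
              (Operad.space (P /⟨ S ⟩) n) (Operad.space (Q /⟨ T ⟩) n) f f-∼
              (λ x y → ≈⇒∼ Q T (f.+ᴹ-homo x y)) (λ r x → ≈⇒∼ Q T (f.*ₗ-homo r x))
          ; injective = λ {x} {y} fx∼fy →
              P/S.≈ᴹ-trans (P/S.≈ᴹ-sym (≈⇒∼ P S (g∘f x)))
              (P/S.≈ᴹ-trans (g-∼ fx∼fy) (≈⇒∼ P S (g∘f y)))
          }
        ; surjective = λ y → g y , λ z∼gy → Q/T.≈ᴹ-trans (f-∼ z∼gy) (≈⇒∼ Q T (f∘g y))
        }
      ; 𝟙-homo = ≈⇒∼ Q T f.𝟙-homo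
      ; compose-homo = λ x i y e → ≈⇒∼ Q T (f.compose-homo x i y e)
      }

  -- Conversion checking of free operads on convertible but syntactically
  -- different sets of generators unfolds all their fields and is infeasible.
  -- Applied to refl, this lemma avoids it.
  presented-isomorphism : (P : Presentation R p) (Q : Presentation R q) →
    let open Presentation in
    ∀ {G H} (G≡ : G ≡ Generator P) (H≡ : H ≡ Generator Q)
    {S : Pred (Operad.Op (Free R G) 3) p} {T : Pred (Operad.Op (Free R H) 3) q}
    {f : ∀ n → Operad.Op (Free R G) n → Operad.Op (Free R H) n}
    {f′ : ∀ n → Operad.Op (Free R (Generator P)) n → Operad.Op (Free R (Generator Q)) n} →
    ≡.subst (λ G → Pred (Operad.Op (Free R G) 3) p) G≡ S ≡ Relation P →
    ≡.subst (λ H → Pred (Operad.Op (Free R H) 3) q) H≡ T ≡ Relation Q →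
    ≡.subst₂ (λ G H → ∀ n → Operad.Op (Free R G) n → Operad.Op (Free R H) n) G≡ H≡ f ≡ f′ →
    IsOperadIsomorphism R (Free R G /⟨ S ⟩) (Free R H /⟨ T ⟩) (f _) →
    IsOperadIsomorphism R (Presented P) (Presented Q) (f′ _)
  presented-isomorphism P Q refl refl {S} {T} {f} {f′} S≡ T≡ f≡ f-iso = cast S≡ T≡ f≡
    where
    cast : S ≡ Presentation.Relation P → T ≡ Presentation.Relation Q → f ≡ f′ →
           IsOperadIsomorphism R (Presented P) (Presented Q) (f′ _)
    cast refl refl refl = f-iso

  -- Evaluation of trees in an operad

  module _ (P : Operad R m₁ ℓ₁) {G : Set} (σ : G → Operad.Op P 2) where
    open Operad P
    private
      module S {n} = LeftModule (space n)
      module Linˡ {m n k} (i : Fin m) (y : Op n) .(e : suc k ≡ m + n) =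
        Linear (space m) (space k) (compose-linearˡ i y e)
      module Linʳ {m n k} (x : Op m) (i : Fin m) .(e : suc k ≡ m + n) =
        Linear (space n) (space k) (compose-linearʳ x i e)

    -- The arity is an argument rather than computed from the tree, so that
    -- no transport is needed.
    evalTree : ∀ t {n} → .(arity t ≡ n) → Op n
    -- The arity equation is irrelevant; decidable equality of natural numbers recovers a proof that
    -- can be matched.
    evalTree leaf         {n} e with recompute (1 ℕ.≟ n) e
    ... | refl = 𝟙
    -- The right subtree is inserted first, so that the left one still goes into input 0 afterwards
    -- and no index depends on an arity.
    evalTree (node x l r) {n} e = compose
      (compose (σ x) (suc zero) (evalTree r refl) refl) zero (evalTree l refl)
      (cong suc (≡.trans (≡.sym e) (ℕ.+-comm (arity l) (arity r))))

    evalTree-cong : ∀ {s t n} .(e : arity s ≡ n) .(e′ : arity t ≡ n) → s ≡ t →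
                    evalTree s e S.≈ᴹ evalTree t e′
    evalTree-cong _ _ refl = S.≈ᴹ-refl

    -- By induction on `s`, the cases are the operad axioms: a leaf is the left unit law, a graft
    -- into the left subtree is sequential associativity, and a graft into the right subtree is
    -- sequential followed by parallel associativity. The position `j` is a natural number tied to
    -- `i` by an equation, so that `split` can match on it.
    evalTree-graft : ∀ s j t {k} (i : Fin (arity s)) → j ≡ toℕ i →
      (e′ : arity (graft s j t) ≡ k) .(e : suc k ≡ arity s + arity t) →
      evalTree (graft s j t) e′ S.≈ᴹ compose (evalTree s refl) i (evalTree t refl) e
    evalTree-graft leaf _ t zero refl refl e = S.≈ᴹ-sym {arity t} (identityˡ (evalTree t refl))
    evalTree-graft (node x l r) o t {k} i o≡i e′ e with split {G} (arity l) o
    ... | left o<l = begin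
      evalTree (graft (node x l r) o t) e′
        ≈⟨ evalTree-cong e′ e″ graft≡ ⟩
      evalTree (node x (graft l o t) r) e″
        ≈⟨ Linʳ.⟦⟧-cong X zero _ (evalTree-graft l o t i′ (≡.sym (Fin.toℕ-fromℕ< o<l)) refl eₗ) ⟩
      compose X zero (compose L i′ T eₗ) _
        ≈⟨ sequential X L T zero i′ i (≡.trans (≡.sym o≡i) (≡.sym (Fin.toℕ-fromℕ< o<l)))
             eᵣₗ e _ _ ⟨
      compose (compose X zero L eᵣₗ) i T e ∎
      where
      open SetoidReasoning (AbelianGroup.setoid (LeftModule.+ᴹ-abelianGroup (space k)))
      i′ = fromℕ< o<l
      X = compose (σ x) (suc zero) (evalTree r refl) refl
      L = evalTree l refl
      T = evalTree t refl
      eᵣₗ = cong suc (ℕ.+-comm (arity l) (arity r))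
      eₗ = arity-graft l o t o<l
      graft≡ = graft-left x l r t o<l
      e″ : arity (node x (graft l o t) r) ≡ k
      e″ = ≡.trans (cong arity (≡.sym graft≡)) e′
    ... | right j = begin
      evalTree (graft (node x l r) (arity l + j) t) e′
        ≈⟨ evalTree-cong e′ e″ graft≡ ⟩
      evalTree (node x l (graft r j t)) e″
        ≈⟨ Linˡ.⟦⟧-cong zero L _ (Linʳ.⟦⟧-cong (σ x) (suc zero) _
             (evalTree-graft r j t i′ (≡.sym (Fin.toℕ-fromℕ< j<r)) refl eᵣ)) ⟩
      compose (compose (σ x) (suc zero) (compose R′ i′ T _) _) zero L _
        ≈⟨ Linˡ.⟦⟧-cong zero L _
             (sequential (σ x) R′ T (suc zero) i′ (suc i′) refl refl _ _ _) ⟨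
      compose (compose X (suc i′) T (cong suc eᵣ)) zero L
        (cong suc (≡.trans (≡.sym e″) (ℕ.+-comm (arity l) _)))
        -- Leaf `j` of `r` is input `suc j` of `X` before `l` is inserted at input 0, and input
        -- `arity l + j` afterwards.
        ≈⟨ parallel X L T zero (suc i′) i zero (s≤s z≤n) i≡ refl
             eᵣₗ e (cong suc eᵣ) _ ⟨
      compose (compose X zero L eᵣₗ) i T e ∎
      where
      open SetoidReasoning (AbelianGroup.setoid (LeftModule.+ᴹ-abelianGroup (space k)))
      j<r : j < arity r
      j<r = ℕ.+-cancelˡ-< (arity l) j (arity r)
        (≡.subst (_< arity l + arity r) (≡.sym o≡i) (Fin.toℕ<n i))
      i′ = fromℕ< j<r
      R′ = evalTree r refl
      X = compose (σ x) (suc zero) R′ refl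
      L = evalTree l refl
      T = evalTree t refl
      graft≡ = graft-right x l r j t
      e″ : arity (node x l (graft r j t)) ≡ k
      e″ = ≡.trans (cong arity (≡.sym graft≡)) e′
      eᵣₗ = cong suc (ℕ.+-comm (arity l) (arity r))
      eᵣ = arity-graft r j t j<r
      i≡ : suc (toℕ i) ≡ suc (toℕ i′) + arity l
      i≡ = cong suc (≡.trans (≡.sym o≡i) (≡.trans (ℕ.+-comm (arity l) j)
        (cong (_+ arity l) (≡.sym (Fin.toℕ-fromℕ< j<r)))))

    eval : ∀ {n} → Operad.Op (Free R G) n → Op n
    eval {n} = extend (space n) (λ t → evalTree (tree t) (arity-tree t))

    private
      evalTree-graftAt : ∀ s t {m n k} (eₛ : arity s ≡ m) (eₜ : arity t ≡ n) (i : Fin m)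
        (e′ : arity (graft s (toℕ i) t) ≡ k) .(e : suc k ≡ m + n) →
        evalTree (graft s (toℕ i) t) e′ S.≈ᴹ compose (evalTree s eₛ) i (evalTree t eₜ) e
      evalTree-graftAt s t refl refl i e′ e = evalTree-graft s (toℕ i) t i refl e′ e

    eval-homomorphism : IsOperadHomomorphism (Free R G) P eval
    eval-homomorphism = record
      { linear       = λ n → extend-linear (space n) _
      ; 𝟙-homo       = S.≈ᴹ-refl
      ; compose-homo = λ {m} {n} {k} x i y e →
          linear-ext (space k)
            (∘-linear {L = F.space m} {F.space k} {space k}
              (extend-linear (space k) _) (F.compose-linearˡ i y e))
            (∘-linear {L = F.space m} {space m} {space k}
              (compose-linearˡ i (eval y) e) (extend-linear (space m) _))
            (λ s → linear-ext (space k)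
              (∘-linear {L = F.space n} {F.space k} {space k}
                (extend-linear (space k) _) (F.compose-linearʳ (var s) i e))
              (∘-linear {L = F.space n} {space n} {space k}
                (compose-linearʳ (eval (var s)) i e) (extend-linear (space n) _))
              (λ t → evalTree-graftAt (tree s) (tree t) (arity-tree s) (arity-tree t) i
                (arity-tree (graftAt s i t e)) e) y) x
      }
      where module F = Operad (Free R G)

    eval-generator : ∀ x → eval (generator R x) S.≈ᴹ σ x
    eval-generator x = S.≈ᴹ-trans (identityʳ _ zero refl) (identityʳ (σ x) (suc zero) refl)

  -- Uniqueness of homomorphisms out of a free operad

  module _ {P : Operad R m₁ ℓ₁} {G : Set} {f g : ∀ {n} → Operad.Op (Free R G) n → Operad.Op P n}
           (f-hom : IsOperadHomomorphism (Free R G) P f) (g-hom : IsOperadHomomorphism (Free R G) P g)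
           (f≈g : ∀ x → Operad._≈ᴹ_ P (f (generator R x)) (g (generator R x))) where
    open Operad P
    private
      module F = Operad (Free R G)
      module S {n} = LeftModule (space n)
      module f = IsOperadHomomorphism f-hom
      module g = IsOperadHomomorphism g-hom

      compose-cong : ∀ {m n k} {x x′ : Op m} (i : Fin m) {y y′ : Op n} .(e : suc k ≡ m + n) →
                     x ≈ᴹ x′ → y ≈ᴹ y′ → compose x i y e ≈ᴹ compose x′ i y′ e
      compose-cong {m} {n} {k} {x′ = x′} i {y = y} e x≈x′ y≈y′ = S.≈ᴹ-trans
        (Linear.⟦⟧-cong (space m) (space k) (compose-linearˡ i y e) x≈x′)
        (Linear.⟦⟧-cong (space n) (space k) (compose-linearʳ x′ i e) y≈y′)

      compose-agree : ∀ {m n k} (x : F.Op m) (i : Fin m) (y : F.Op n) .(e : suc k ≡ m + n) →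
                      f x ≈ᴹ g x → f y ≈ᴹ g y → f (F.compose x i y e) ≈ᴹ g (F.compose x i y e)
      compose-agree x i y e fx≈gx fy≈gy = S.≈ᴹ-trans (f.compose-homo x i y e)
        (S.≈ᴹ-trans (compose-cong i e fx≈gx fy≈gy) (S.≈ᴹ-sym (g.compose-homo x i y e)))

      agree-tree : ∀ t {n} (e : arity t ≡ n) → f (var (t , e)) ≈ᴹ g (var (t , e))
      agree-tree leaf         refl = S.≈ᴹ-trans f.𝟙-homo (S.≈ᴹ-sym g.𝟙-homo)
      -- By computation `node x l r` is the composite (x ∘₂ r) ∘₁ l, so agreement on generators
      -- propagates to all trees.
      agree-tree (node x l r) refl = compose-agree
        (F.compose (generator R x) (suc zero) (var (r , refl)) refl) zero (var (l , refl))
        (cong suc (ℕ.+-comm (arity l) (arity r)))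
        (compose-agree (generator R x) (suc zero) (var (r , refl)) refl (f≈g x) (agree-tree r refl))
        (agree-tree l refl)

    homomorphism-ext : ∀ {n} (x : F.Op n) → f x ≈ᴹ g x
    homomorphism-ext {n} = linear-ext (space n) (f.linear n) (g.linear n)
      (λ t → agree-tree (tree t) (arity-tree t))

  -- Linear combinations indexed by Fin n

  module _ (M : LeftModule ring m ℓm) where
    private module Sum = CommutativeMonoidSum (LeftModule.+ᴹ-commutativeMonoid M)
    open LeftModule M

    ∑ : ∀ {n} → (Fin n → Carrierᴹ) → Carrierᴹ
    ∑ = Sum.sum

    ∑-cong : ∀ {n} {u v : Fin n → Carrierᴹ} → (∀ i → u i ≈ᴹ v i) → ∑ u ≈ᴹ ∑ v
    ∑-cong = Sum.sum-cong-≋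

    ∑-zero : ∀ n → ∑ {n} (λ _ → 0ᴹ) ≈ᴹ 0ᴹ
    ∑-zero = Sum.sum-replicate-zero

    ∑-comm : ∀ {n k} (v : Fin n → Fin k → Carrierᴹ) →
             ∑ (λ i → ∑ (λ j → v i j)) ≈ᴹ ∑ (λ j → ∑ (λ i → v i j))
    ∑-comm = Sum.∑-comm

    *ₗ-distribˡ-∑ : ∀ r {n} (v : Fin n → Carrierᴹ) → r *ₗ ∑ v ≈ᴹ ∑ (λ i → r *ₗ v i)
    *ₗ-distribˡ-∑ r {zero}  v = *ₗ-zeroʳ r
    *ₗ-distribˡ-∑ r {suc n} v = ≈ᴹ-trans (*ₗ-distribˡ r _ _)
      (+ᴹ-congˡ (*ₗ-distribˡ-∑ r (λ i → v (suc i))))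

    *ₗ-distribʳ-∑ : ∀ {n} (r : Fin n → Carrier) x → RS.sum r *ₗ x ≈ᴹ ∑ (λ i → r i *ₗ x)
    *ₗ-distribʳ-∑ {zero}  r x = *ₗ-zeroˡ x
    *ₗ-distribʳ-∑ {suc n} r x = ≈ᴹ-trans (*ₗ-distribʳ x _ _)
      (+ᴹ-congˡ (*ₗ-distribʳ-∑ (λ i → r (suc i)) x))

  module _ {M : LeftModule ring m₁ ℓ₁} {N : LeftModule ring m₂ ℓ₂}
           {f : LeftModule.Carrierᴹ M → LeftModule.Carrierᴹ N} (f-linear : IsLinear M N f) where
    private module f = Linear M N f-linear
    open LeftModule N

    linear-∑ : ∀ {n} (v : Fin n → LeftModule.Carrierᴹ M) → f (∑ M v) ≈ᴹ ∑ N (λ i → f (v i))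
    linear-∑ {zero}  v = f.0ᴹ-homo
    linear-∑ {suc n} v = ≈ᴹ-trans (f.+ᴹ-homo _ _) (+ᴹ-congˡ (linear-∑ (λ i → v (suc i))))

    linear-combination : ∀ {n} (r : Fin n → Carrier) (v : Fin n → LeftModule.Carrierᴹ M) →
      f (∑ M (λ i → LeftModule._*ₗ_ M (r i) (v i))) ≈ᴹ ∑ N (λ i → r i *ₗ f (v i))
    linear-combination r v = ≈ᴹ-trans (linear-∑ (λ i → LeftModule._*ₗ_ M (r i) (v i)))
      (∑-cong N (λ i → f.*ₗ-homo (r i) (v i)))

  -- Spans under linear maps

  module _ {M : LeftModule ring m₁ ℓ₁} {N : LeftModule ring m₂ ℓ₂}
           {f : LeftModule.Carrierᴹ M → LeftModule.Carrierᴹ N} (f-linear : IsLinear M N f)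
           {S : Pred (LeftModule.Carrierᴹ M) p} where
    private module f = Linear M N f-linear
    open LeftModule N

    -- A kernel is a submodule. With a pairing as `f`, this reduces annihilating the relation space
    -- of As to annihilating its relators.
    Span-kernel : (∀ {x} → S x → f x ≈ᴹ 0ᴹ) → ∀ {x} → Span M S x → f x ≈ᴹ 0ᴹ
    Span-kernel S⇒0 (gen x∈)      = S⇒0 x∈
    Span-kernel S⇒0 0∈            = f.0ᴹ-homo
    Span-kernel S⇒0 (+∈ x∈ y∈)    = ≈ᴹ-trans (f.+ᴹ-homo _ _)
      (≈ᴹ-trans (+ᴹ-cong (Span-kernel S⇒0 x∈) (Span-kernel S⇒0 y∈)) (+ᴹ-identityˡ 0ᴹ))
    Span-kernel S⇒0 (*∈ r x∈)     = ≈ᴹ-trans (f.*ₗ-homo r _)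
      (≈ᴹ-trans (*ₗ-congˡ (Span-kernel S⇒0 x∈)) (*ₗ-zeroʳ r))
    Span-kernel S⇒0 (resp x≈y x∈) = ≈ᴹ-trans (≈ᴹ-sym (f.⟦⟧-cong x≈y)) (Span-kernel S⇒0 x∈)

  module _ (P : Operad R m ℓm) {d} (T : Pred (Operad.Op P d) q) {n : ℕ} where
    open Operad P
    private module S = LeftModule (space n)

    ∑∈ : ∀ {k} {v : Fin k → Op n} → (∀ i → Ideal P T (v i)) → Ideal P T (∑ (space n) v)
    ∑∈ {zero}  v∈ = 0∈
    ∑∈ {suc k} v∈ = +∈ (v∈ zero) (∑∈ (λ i → v∈ (suc i)))

    Span-Ideal : {M : LeftModule ring m₁ ℓ₁} {f : LeftModule.Carrierᴹ M → Op n}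
                 (f-linear : IsLinear M (space n) f) {S : Pred (LeftModule.Carrierᴹ M) p} →
                 (∀ {x} → S x → Ideal P T (f x)) → ∀ {x} → Span M S x → Ideal P T (f x)
    Span-Ideal {M = M} {f} f-linear {S} S⇒T = go
      where
      module f = Linear M (space n) f-linear
      go : ∀ {x} → Span M S x → Ideal P T (f x)
      go (gen x∈)      = S⇒T x∈
      go 0∈            = resp (S.≈ᴹ-sym f.0ᴹ-homo) 0∈
      go (+∈ x∈ y∈)    = resp (S.≈ᴹ-sym (f.+ᴹ-homo _ _)) (+∈ (go x∈) (go y∈))
      go (*∈ r x∈)     = resp (S.≈ᴹ-sym (f.*ₗ-homo r _)) (*∈ r (go x∈))
      go (resp x≈y x∈) = resp (f.⟦⟧-cong x≈y) (go x∈)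

  -- Kronecker delta, zeta matrix and its inverse

  δ : ∀ {n} → Fin n → Fin n → Carrier
  δ x y = if does (x Fin.≟ y) then 1# else 0#

  δ-sym : ∀ {n} (x y : Fin n) → δ x y ≡ δ y x
  δ-sym zero    zero    = refl
  δ-sym zero    (suc y) = refl
  δ-sym (suc x) zero    = refl
  δ-sym (suc x) (suc y) = δ-sym x y

  module _ (M : LeftModule ring m ℓm) where
    open LeftModule M

    ∑-δ : ∀ {n} (x : Fin n) (v : Fin n → Carrierᴹ) → ∑ M (λ y → δ x y *ₗ v y) ≈ᴹ v x
    ∑-δ {suc n} zero    v = ≈ᴹ-trans
      (+ᴹ-cong (*ₗ-identityˡ _) (≈ᴹ-trans (∑-cong M (λ i → *ₗ-zeroˡ (v (suc i)))) (∑-zero M n)))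
      (+ᴹ-identityʳ _)
    ∑-δ {suc n} (suc x) v = ≈ᴹ-trans
      (+ᴹ-cong (*ₗ-zeroˡ _) (∑-δ x (λ y → v (suc y)))) (+ᴹ-identityˡ _)

  -- The zeta matrix of the chain Fin n, and its inverse.
  ζ μ : ∀ {n} → Fin n → Fin n → Carrier
  ζ _       zero    = 1#
  ζ zero    (suc x) = 0#
  ζ (suc b) (suc x) = ζ b x

  μ zero    zero    = 1#
  μ zero    (suc b) = 0#
  -- Column zero of `ζ` is constantly 1, so every row of `μ` after the first must sum to 0. In
  -- closed form such a row has 1 on the diagonal, -1 just before it and 0 elsewhere.
  μ (suc x) zero    = R.- RS.sum (μ x)
  μ (suc x) (suc b) = μ x b

  ζ-≤ : ∀ {n} {b x : Fin n} → x ≤ b → ζ b x ≡ 1#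
  ζ-≤ {x = zero}              _         = refl
  ζ-≤ {b = suc b} {x = suc x} (s≤s x≤b) = ζ-≤ {b = b} x≤b

  ζ-≰ : ∀ {n} {b x : Fin n} → ¬ x ≤ b → ζ b x ≡ 0#
  ζ-≰ {x = zero}              x≰b = contradiction z≤n x≰b
  ζ-≰ {b = zero}  {x = suc x} x≰b = refl
  ζ-≰ {b = suc b} {x = suc x} x≰b = ζ-≰ {b = b} (λ x≤b → x≰b (s≤s x≤b))

  private
    infix 4 _≈_
    _≈_ = R._≈_

    ∑0≈0 : ∀ {n} {r : Fin n → Carrier} → (∀ i → r i ≈ 0#) → RS.sum r ≈ 0#
    ∑0≈0 {n} r≈0 = R.trans (RS.sum-cong-≋ r≈0) (RS.sum-replicate-zero n)

  ζ-μ : ∀ {n} (b x : Fin n) → RS.sum (λ y → ζ b y R.* μ y x) ≈ δ b x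
  ζ-μ {suc n} zero    x       = R.trans
    (R.+-cong (R.*-identityˡ _) (∑0≈0 {n} (λ y → R.zeroˡ _))) (R.trans (R.+-identityʳ _) (μ₀ x))
    where
    μ₀ : ∀ x → μ zero x ≈ δ zero x
    μ₀ zero    = R.refl
    μ₀ (suc x) = R.refl
  -- The expected entry is 0. Once the sums are exchanged, the induction hypothesis turns the double
  -- sum into a row sum of `δ`, which is 1 and cancels the leading 1.
  ζ-μ {suc n} (suc b) zero    = begin
    1# R.* 1# R.+ RS.sum (λ y → ζ b y R.* (R.- RS.sum (μ y)))
      ≈⟨ R.+-cong (R.*-identityˡ 1#) (RS.sum-cong-≋ (λ y → R.sym (RP.-‿distribʳ-* (ζ b y) _))) ⟩
    1# R.+ RS.sum (λ y → R.- (ζ b y R.* RS.sum (μ y)))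
      ≈⟨ R.+-congˡ (R.sym (linear-∑ {M = K} {K} neg-linear (λ y → ζ b y R.* RS.sum (μ y)))) ⟩
    1# R.+ R.- RS.sum (λ y → ζ b y R.* RS.sum (μ y))
      ≈⟨ R.+-congˡ (R.-‿cong (RS.sum-cong-≋ (λ y → RS.*-distribˡ-sum (ζ b y) (μ y)))) ⟩
    1# R.+ R.- RS.sum (λ y → RS.sum (λ z → ζ b y R.* μ y z))
      ≈⟨ R.+-congˡ (R.-‿cong (R.trans (RS.∑-comm {n} {n} (λ y z → ζ b y R.* μ y z))
           (RS.sum-cong-≋ (ζ-μ b)))) ⟩
    1# R.+ R.- RS.sum (δ b)
      ≈⟨ R.+-congˡ (R.-‿cong (R.trans (RS.sum-cong-≋ (λ y → R.sym (R.*-identityʳ (δ b y))))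
           (∑-δ K b (λ _ → 1#)))) ⟩
    1# R.+ R.- 1#
      ≈⟨ R.-‿inverseʳ 1# ⟩
    0# ∎
    where
    open SetoidReasoning R.setoid
    module RP = RingProperties ring
    K = regularModule {R = ring}
    neg-linear : IsLinear K K (λ r → R.- r)
    neg-linear = mkLinear K K (λ r → R.- r) R.-‿cong (λ x y → R.sym (RP.-‿+-comm x y))
      (λ r x → RP.-‿distribʳ-* r x)
  ζ-μ {suc n} (suc b) (suc x) = R.trans (R.+-cong (R.zeroʳ _) (ζ-μ b x)) (R.+-identityˡ _)

  μ-ζ : ∀ {n} (x b : Fin n) → RS.sum (λ y → μ x y R.* ζ y b) ≈ δ x b
  μ-ζ {suc n} zero    zero    = R.trans
    (R.+-cong (R.*-identityˡ _) (∑0≈0 {n} (λ y → R.zeroˡ _))) (R.+-identityʳ _)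
  μ-ζ {suc n} zero    (suc b) = R.trans
    (R.+-cong (R.*-identityˡ _) (∑0≈0 {n} (λ y → R.zeroˡ _))) (R.+-identityʳ _)
  μ-ζ {suc n} (suc x) zero    = R.trans
    (R.+-cong (R.*-identityʳ _) (RS.sum-cong-≋ (λ y → R.*-identityʳ (μ x y)))) (R.-‿inverseˡ _)
  μ-ζ {suc n} (suc x) (suc b) = R.trans (R.+-cong (R.zeroʳ _) (μ-ζ x b)) (R.+-identityˡ _)

  module _ (M : LeftModule ring m ℓm) where
    open LeftModule M

    -- Substituting one change of basis into the other multiplies the two matrices.
    ∑-inverse : ∀ {n} {A B : Fin n → Fin n → Carrier} →
                (∀ i k → RS.sum (λ j → A i j R.* B j k) ≈ δ i k) →
                ∀ (v : Fin n → Carrierᴹ) i → ∑ M (λ j → A i j *ₗ ∑ M (λ k → B j k *ₗ v k)) ≈ᴹ v i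
    ∑-inverse {A = A} {B} AB v i =
      ≈ᴹ-trans (∑-cong M (λ j → *ₗ-distribˡ-∑ M (A i j) (λ k → B j k *ₗ v k)))
      (≈ᴹ-trans (∑-comm M (λ j k → A i j *ₗ B j k *ₗ v k))
      (≈ᴹ-trans (∑-cong M (λ k → ≈ᴹ-trans
        (∑-cong M (λ j → ≈ᴹ-sym (*ₗ-assoc (A i j) (B j k) (v k))))
        (≈ᴹ-trans (≈ᴹ-sym (*ₗ-distribʳ-∑ M (λ j → A i j R.* B j k) (v k))) (*ₗ-congʳ (AB i k)))))
      (∑-δ M i v)))

    foldr-filter : ∀ {A : Set} {P : Pred A 0ℓ} (P? : Decidable P) {n}
      (g : Fin n → A) (v : A → Carrierᴹ) →
      foldr _+ᴹ_ 0ᴹ (map v (filter P? (tabulate g))) ≈ᴹ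
      ∑ M (λ i → (if does (P? (g i)) then 1# else 0#) *ₗ v (g i))
    foldr-filter P? {zero}  g v = ≈ᴹ-refl
    foldr-filter P? {suc n} g v with does (P? (g zero))
    ... | true  = +ᴹ-cong (≈ᴹ-sym (*ₗ-identityˡ _)) (foldr-filter P? (λ i → g (suc i)) v)
    ... | false = ≈ᴹ-trans (foldr-filter P? (λ i → g (suc i)) v)
      (≈ᴹ-trans (≈ᴹ-sym (+ᴹ-identityˡ _)) (+ᴹ-congʳ (≈ᴹ-sym (*ₗ-zeroˡ _))))

    foldr-filter-≤ : ∀ {n} (b : Fin n) (v : Fin n → Carrierᴹ) →
      foldr _+ᴹ_ 0ᴹ (map v (filter (Fin._≤? b) (allFin n))) ≈ᴹ ∑ M (λ x → ζ b x *ₗ v x)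
    foldr-filter-≤ b v = ≈ᴹ-trans (foldr-filter (Fin._≤? b) (λ i → i) v)
      (∑-cong M (λ x → *ₗ-congʳ (R.reflexive (if≡ζ (x Fin.≤? b)))))
      where
      if≡ζ : ∀ {x} (x≤?b : Dec (x ≤ b)) → (if does x≤?b then 1# else 0#) ≡ ζ b x
      if≡ζ (yes x≤b) = ≡.sym (ζ-≤ x≤b)
      if≡ζ (no  x≰b) = ≡.sym (ζ-≰ x≰b)

  module _ {n : ℕ} where
    open Max (Fin.≤-totalOrder n) using (⊔-lub; x⊔y≤z⇒x≤z; x⊔y≤z⇒y≤z) renaming (_⊔_ to _↑_)

    -- A maximum lies below `b` exactly if both arguments do. Here the operation `↑` of As meets the
    -- indicator functions.
    ζ-↑ : ∀ b x y → ζ b x R.* ζ b y ≈ ζ b (x ↑ y)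
    ζ-↑ b x y with x Fin.≤? b | y Fin.≤? b
    ... | yes x≤b | yes y≤b
      rewrite ζ-≤ x≤b | ζ-≤ y≤b | ζ-≤ (⊔-lub x≤b y≤b) = R.*-identityˡ 1#
    ... | no  x≰b | _
      rewrite ζ-≰ x≰b | ζ-≰ {b = b} {x ↑ y} (λ h → x≰b (x⊔y≤z⇒x≤z x y h)) = R.zeroˡ _
    ... | yes _   | no  y≰b
      rewrite ζ-≰ y≰b | ζ-≰ {b = b} {x ↑ y} (λ h → y≰b (x⊔y≤z⇒y≤z x y h)) = R.zeroʳ _

  -- Linearity of pointwise constructions

  module _ {M : LeftModule ring m₁ ℓ₁} {N : LeftModule ring m₂ ℓ₂} where
    open LeftModule N
    private
      module M = LeftModule M

      Lin : (M.Carrierᴹ → Carrierᴹ) → Set _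
      Lin = IsLinear M N

    0-linear : Lin (λ _ → 0ᴹ)
    0-linear = mkLinear M N _
      (λ _ → ≈ᴹ-refl) (λ _ _ → ≈ᴹ-sym (+ᴹ-identityˡ 0ᴹ)) (λ r _ → ≈ᴹ-sym (*ₗ-zeroʳ r))

    +-linear : ∀ {f g} → Lin f → Lin g → Lin (λ x → f x +ᴹ g x)
    +-linear {f} {g} f-linear g-linear = mkLinear M N _
      (λ x≈y → +ᴹ-cong (f.⟦⟧-cong x≈y) (g.⟦⟧-cong x≈y))
      (λ x y → ≈ᴹ-trans (+ᴹ-cong (f.+ᴹ-homo x y) (g.+ᴹ-homo x y))
        (interchange (f x) (f y) (g x) (g y)))
      (λ r x → ≈ᴹ-trans (+ᴹ-cong (f.*ₗ-homo r x) (g.*ₗ-homo r x))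
        (≈ᴹ-sym (*ₗ-distribˡ r (f x) (g x))))
      where
      module f = Linear M N f-linear
      module g = Linear M N g-linear
      open CommutativeSemigroupProperties
        (CommutativeMonoid.commutativeSemigroup +ᴹ-commutativeMonoid) using (interchange)

    *-linear : ∀ s {f} → Lin f → Lin (λ x → s *ₗ f x)
    *-linear s {f} f-linear = mkLinear M N _
      (λ x≈y → *ₗ-congˡ (f.⟦⟧-cong x≈y))
      (λ x y → ≈ᴹ-trans (*ₗ-congˡ (f.+ᴹ-homo x y)) (*ₗ-distribˡ s (f x) (f y)))
      (λ r x → ≈ᴹ-trans (*ₗ-congˡ (f.*ₗ-homo r x)) (≈ᴹ-trans (≈ᴹ-sym (*ₗ-assoc s r (f x)))
        (≈ᴹ-trans (*ₗ-congʳ (R.*-comm s r)) (*ₗ-assoc r s (f x)))))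
      where module f = Linear M N f-linear

    ∑-linear : ∀ {n} {f : Fin n → M.Carrierᴹ → Carrierᴹ} → (∀ i → Lin (f i)) →
               Lin (λ x → ∑ N (λ i → f i x))
    ∑-linear {zero}  f-linear = 0-linear
    ∑-linear {suc n} f-linear = +-linear (f-linear zero) (∑-linear (λ i → f-linear (suc i)))

    -- Meant for the second argument of `form`, which sits in the inner of two nested extensions;
    -- linearity in it is proved by induction on the first argument.
    extend-family-linear : ∀ {A : Set} {f : A → M.Carrierᴹ → Carrierᴹ} → (∀ a → Lin (f a)) →
                           ∀ u → Lin (λ x → extend N (λ a → f a x) u)
    extend-family-linear f-linear (var a) = f-linear a
    extend-family-linear f-linear 𝟎       = 0-linear
    extend-family-linear f-linear (u ⊕ v) =
      +-linear (extend-family-linear f-linear u) (extend-family-linear f-linear v)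
    extend-family-linear f-linear (r ⊛ u) = *-linear r (extend-family-linear f-linear u)

  module _ (M : LeftModule ring m ℓm) where
    open LeftModule M

    ∑-δ₂ : ∀ {n} (p q : Fin n) (v : Fin n → Fin n → Carrierᴹ) →
      ∑ M (λ x → ∑ M (λ y → (δ p x R.* δ q y) *ₗ v x y)) ≈ᴹ v p q
    ∑-δ₂ p q v = ≈ᴹ-trans
      (∑-cong M (λ x → ≈ᴹ-trans
        (∑-cong M (λ y → *ₗ-assoc (δ p x) (δ q y) (v x y)))
        (≈ᴹ-trans (≈ᴹ-sym (*ₗ-distribˡ-∑ M (δ p x) (λ y → δ q y *ₗ v x y)))
          (*ₗ-congˡ (∑-δ M q (v x))))))
      (∑-δ M p (λ x → v x q))

    scalar-linear : ∀ {N : LeftModule R.ring m₁ ℓ₁} {f : LeftModule.Carrierᴹ N → R.Carrier} →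
                    IsLinear N (regularModule {R = R.ring}) f → ∀ v → IsLinear N M (λ x → f x *ₗ v)
    scalar-linear {N = N} {f} f-linear v = mkLinear N M _
      (λ x≈y → *ₗ-congʳ (f.⟦⟧-cong x≈y))
      (λ x y → ≈ᴹ-trans (*ₗ-congʳ (f.+ᴹ-homo x y)) (*ₗ-distribʳ v (f x) (f y)))
      (λ r x → ≈ᴹ-trans (*ₗ-congʳ (f.*ₗ-homo r x)) (*ₗ-assoc r (f x) v))
      where module f = Linear N (regularModule {R = R.ring}) f-linear

  -- The elements N(d) of arity 3

  module _ (γ : ℕ) where
    private
      module RP = RingProperties R.ring
      K = regularModule {R = R.ring}
      module F = Operad (Free R (Fin γ))
      module FS {n} = LeftModule (F.space n)
      _≟_ = Fin._≟_ {γ}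
    open R using (_*_) renaming (Carrier to A)
    open F using (Op; _≈ᴹ_; _+ᴹ_; _*ₗ_; _-ᴹ_; 0ᴹ)
    open Max (Fin.≤-totalOrder γ) using () renaming (_⊔_ to _↑_)

    private
      g : Fin γ → Op 2
      g = generator R

      ⟨_,_⟩ : Op 3 → Op 3 → A
      ⟨_,_⟩ = form R _≟_

      _●₁_ _●₂_ : Op 2 → Op 2 → Op 3
      _●₁_ = _∘₁_ R
      _●₂_ = _∘₂_ R
      infixl 7 _●₁_ _●₂_

      ∑₃ : (Fin γ → Op 3) → Op 3
      ∑₃ = ∑ (F.space 3)

    -- On two generators this is w(x,y). Allowing all elements of arity 2 makes it bilinear, so that
    -- it can be expanded at combinations of generators.
    associator : Op 2 → Op 2 → Op 3
    associator u v = (u ●₁ v) -ᴹ (u ●₂ v)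

    -- The element N(d): the coefficient of w(x,y) depends on the pair only through its maximum.
    maxSum : (Fin γ → A) → Op 3
    maxSum d = ∑₃ (λ x → ∑₃ (λ y → d (x ↑ y) *ₗ associator (g x) (g y)))

    form-linearˡ : ∀ v → IsLinear (F.space 3) K (λ u → ⟨ u , v ⟩)
    form-linearˡ v = extend-linear K _

    form-linearʳ : ∀ u → IsLinear (F.space 3) K (λ v → ⟨ u , v ⟩)
    form-linearʳ = extend-family-linear {M = F.space 3} {N = K}
      (λ s → extend-linear K (λ t → treeForm R _≟_ (tree s) (tree t)))

    associator-linearˡ : ∀ v → IsLinear (F.space 2) (F.space 3) (λ u → associator u v)
    associator-linearˡ v = +-linear {M = F.space 2} {N = F.space 3} (F.compose-linearˡ zero v refl)
      -- Negation in the free module is multiplication by -1.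
      (*-linear {M = F.space 2} {N = F.space 3} (R.- 1#) (F.compose-linearˡ (suc zero) v refl))

    associator-linearʳ : ∀ u → IsLinear (F.space 2) (F.space 3) (associator u)
    associator-linearʳ u = +-linear {M = F.space 2} {N = F.space 3} (F.compose-linearʳ u zero refl)
      (*-linear {M = F.space 2} {N = F.space 3} (R.- 1#) (F.compose-linearʳ u (suc zero) refl))

    associator-cong : ∀ {u u′ v v′} → u ≈ᴹ u′ → v ≈ᴹ v′ → associator u v ≈ᴹ associator u′ v′
    associator-cong {u′ = u′} {v} u≈u′ v≈v′ = FS.≈ᴹ-trans
      (Linear.⟦⟧-cong (F.space 2) (F.space 3) (associator-linearˡ v) u≈u′)
      (Linear.⟦⟧-cong (F.space 2) (F.space 3) (associator-linearʳ u′) v≈v′)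

    associator-homo : ∀ {f : ∀ {n} → Op n → Op n} →
      IsOperadHomomorphism (Free R (Fin γ)) (Free R (Fin γ)) f →
      ∀ u v → f (associator u v) ≈ᴹ associator (f u) (f v)
    associator-homo {f} f-hom u v = FS.≈ᴹ-trans (f.+ᴹ-homo _ _) (FS.+ᴹ-cong
      (f.compose-homo u zero v refl)
      (FS.≈ᴹ-trans (f.-ᴹ-homo _) (FS.-ᴹ‿cong (f.compose-homo u (suc zero) v refl))))
      where module f = IsOperadHomomorphism f-hom

    ζ-combination : Fin γ → Op 2
    ζ-combination b = ∑ (F.space 2) (λ x → ζ b x *ₗ g x)

    associator-ζ : ∀ b → associator (ζ-combination b) (ζ-combination b) ≈ᴹ maxSum (ζ b)
    associator-ζ b = begin
      associator (ζ-combination b) (ζ-combination b)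
        ≈⟨ linear-combination {M = F.space 2} {F.space 3}
             (associator-linearˡ (ζ-combination b)) (ζ b) g ⟩
      ∑₃ (λ x → ζ b x *ₗ associator (g x) (ζ-combination b))
        ≈⟨ ∑-cong (F.space 3) (λ x → FS.*ₗ-congˡ
             (linear-combination {M = F.space 2} {F.space 3} (associator-linearʳ (g x)) (ζ b) g)) ⟩
      ∑₃ (λ x → ζ b x *ₗ ∑₃ (λ y → ζ b y *ₗ associator (g x) (g y)))
        ≈⟨ ∑-cong (F.space 3) (λ x → FS.≈ᴹ-trans
             (*ₗ-distribˡ-∑ (F.space 3) (ζ b x) (λ y → ζ b y *ₗ associator (g x) (g y)))
             (∑-cong (F.space 3) (λ y → FS.≈ᴹ-trans
               (FS.≈ᴹ-sym (FS.*ₗ-assoc (ζ b x) (ζ b y) _)) (FS.*ₗ-congʳ (ζ-↑ b x y))))) ⟩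
      maxSum (ζ b) ∎
      where open SetoidReasoning (AbelianGroup.setoid (LeftModule.+ᴹ-abelianGroup (F.space 3)))

    -- Pairings with combs

    private
      if-∧ : ∀ a b → (if a ∧ b then 1# else 0#) R.≈
                     (if a then 1# else 0#) * (if b then 1# else 0#)
      if-∧ true  b = R.sym (R.*-identityˡ _)
      if-∧ false b = R.sym (R.zeroˡ _)

      -if : ∀ b → (if b then R.- 1# else 0#) R.≈ R.- (if b then 1# else 0#)
      -if true  = R.refl
      -if false = R.sym RP.-0#≈0#

      -1*-if : ∀ b → R.- 1# * (if b then R.- 1# else 0#) R.≈ (if b then 1# else 0#)
      -1*-if b = R.trans (RP.-1*x≈-x _) (R.trans (R.-‿cong (-if b)) (RP.-‿involutive _))

    form-associator₁ : ∀ p q x y →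
      ⟨ g p ●₁ g q , associator (g x) (g y) ⟩ R.≈ δ p x * δ q y
    form-associator₁ p q x y = R.trans
      (R.+-cong (if-∧ (does (p ≟ x)) (does (q ≟ y))) (R.zeroʳ _)) (R.+-identityʳ _)

    -- The form is negative on right combs and the associator subtracts the right comb. The two
    -- signs cancel, so left and right combs pair equally with w(x,y).
    form-associator₂ : ∀ p q x y →
      ⟨ g p ●₂ g q , associator (g x) (g y) ⟩ R.≈ δ p x * δ q y
    form-associator₂ p q x y = R.trans (R.+-identityˡ _)
      (R.trans (-1*-if (does (p ≟ x) ∧ does (q ≟ y))) (if-∧ (does (p ≟ x)) (does (q ≟ y))))

    -- Among all w(x,y) only the one at (p,q) survives. A general functional is used so that left
    -- and right combs share the argument.
    functional-maxSum : ∀ {f : Op 3 → A} → IsLinear (F.space 3) K f → ∀ p q →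
      (∀ x y → f (associator (g x) (g y)) R.≈ δ p x * δ q y) →
      ∀ d → f (maxSum d) R.≈ d (p ↑ q)
    functional-maxSum {f} f-linear p q f-associator d = begin
      f (maxSum d)
        ≈⟨ linear-∑ {M = F.space 3} {K} f-linear
             (λ x → ∑₃ (λ y → d (x ↑ y) *ₗ associator (g x) (g y))) ⟩
      RS.sum (λ x → f (∑₃ (λ y → d (x ↑ y) *ₗ associator (g x) (g y))))
        ≈⟨ RS.sum-cong-≋ (λ x → R.trans
             (linear-combination {M = F.space 3} {K} f-linear
               (λ y → d (x ↑ y)) (λ y → associator (g x) (g y)))
             (RS.sum-cong-≋ (λ y → R.trans (R.*-congˡ (f-associator x y)) (R.*-comm _ _)))) ⟩
      RS.sum (λ x → RS.sum (λ y → δ p x * δ q y * d (x ↑ y)))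
        ≈⟨ ∑-δ₂ K p q (λ x y → d (x ↑ y)) ⟩
      d (p ↑ q) ∎
      where open SetoidReasoning R.setoid

    form-maxSum₁ : ∀ p q d → ⟨ g p ●₁ g q , maxSum d ⟩ R.≈ d (p ↑ q)
    form-maxSum₁ p q = functional-maxSum (form-linearʳ (g p ●₁ g q)) p q (form-associator₁ p q)

    form-maxSum₂ : ∀ p q d → ⟨ g p ●₂ g q , maxSum d ⟩ R.≈ d (p ↑ q)
    form-maxSum₂ p q = functional-maxSum (form-linearʳ (g p ●₂ g q)) p q (form-associator₂ p q)

    private
      -- Combs are orthogonal for the form, a left comb pairing with itself to 1 and a right comb to
      -- -1; the factor -1 therefore turns the second pairing into the coordinate on the right comb.
      term : Op 3 → Fin γ → Fin γ → Op 3
      term u x y = ⟨ g x ●₁ g y , u ⟩ *ₗ (g x ●₁ g y) +ᴹ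
                   (R.- 1#) *ₗ ⟨ g x ●₂ g y , u ⟩ *ₗ (g x ●₂ g y)

      expansion : Op 3 → Op 3
      expansion u = ∑₃ (λ x → ∑₃ (term u x))

      expansion-linear : IsLinear (F.space 3) (F.space 3) expansion
      expansion-linear = ∑-linear {M = F.space 3} {N = F.space 3} (λ x →
        ∑-linear {M = F.space 3} {N = F.space 3} (λ y →
          +-linear {M = F.space 3} {N = F.space 3}
            (scalar-linear (F.space 3) {N = F.space 3} (form-linearʳ (g x ●₁ g y)) _)
            (*-linear {M = F.space 3} {N = F.space 3} (R.- 1#)
              (scalar-linear (F.space 3) {N = F.space 3} (form-linearʳ (g x ●₂ g y)) _))))

      δ₂ : ∀ p q x y → (if does (x ≟ p) ∧ does (y ≟ q) then 1# else 0#) R.≈ δ p x * δ q y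
      δ₂ p q x y = R.trans (if-∧ (does (x ≟ p)) (does (y ≟ q)))
        (R.*-cong (R.reflexive (δ-sym x p)) (R.reflexive (δ-sym y q)))

      expansion-comb : ∀ t .(e : arity t ≡ 3) → Arity3 t → expansion (var (t , e)) ≈ᴹ var (t , e)
      expansion-comb _ e (leftComb p q) = FS.≈ᴹ-trans
        (∑-cong (F.space 3) (λ x → ∑-cong (F.space 3) (λ y → FS.≈ᴹ-trans
          (FS.+ᴹ-cong (FS.*ₗ-congʳ (δ₂ p q x y))
            (FS.≈ᴹ-trans (FS.*ₗ-congˡ (FS.*ₗ-zeroˡ _)) (FS.*ₗ-zeroʳ _)))
          (FS.+ᴹ-identityʳ _))))
        (∑-δ₂ (F.space 3) p q (λ x y → g x ●₁ g y))
      expansion-comb _ e (rightComb p q) = FS.≈ᴹ-trans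
        (∑-cong (F.space 3) (λ x → ∑-cong (F.space 3) (λ y → FS.≈ᴹ-trans
          (FS.+ᴹ-cong (FS.*ₗ-zeroˡ _) (FS.≈ᴹ-trans (FS.≈ᴹ-sym (FS.*ₗ-assoc _ _ _))
            (FS.*ₗ-congʳ (R.trans (-1*-if (does (x ≟ p) ∧ does (y ≟ q))) (δ₂ p q x y)))))
          (FS.+ᴹ-identityˡ _))))
        (∑-δ₂ (F.space 3) p q (λ x y → g x ●₂ g y))

    -- Every element of arity 3 equals its `expansion`, hence is determined by its pairings with
    -- combs. Under the two hypotheses the left and right coordinates are opposite and combine to
    -- multiples of w(x,y).
    maxSum-expansion : ∀ d {u} →
      (∀ x y → ⟨ g x ●₁ g y , u ⟩ R.≈ d (x ↑ y)) → (∀ x y → ⟨ g x ●₂ g y , u ⟩ R.≈ d (x ↑ y)) →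
      u ≈ᴹ maxSum d
    maxSum-expansion d {u} form₁ form₂ = FS.≈ᴹ-trans
      (FS.≈ᴹ-sym (linear-ext (F.space 3) expansion-linear (id-linear (F.space 3))
        (λ t → expansion-comb (tree t) (arity-tree t) (arity3 (tree t) (arity-tree t))) u))
      (∑-cong (F.space 3) (λ x → ∑-cong (F.space 3) (λ y → FS.≈ᴹ-trans
        (FS.+ᴹ-cong (FS.*ₗ-congʳ (form₁ x y)) (FS.≈ᴹ-trans (FS.*ₗ-congˡ (FS.*ₗ-congʳ (form₂ x y)))
          (FS.≈ᴹ-trans (FS.≈ᴹ-sym (FS.*ₗ-assoc _ _ _))
            (FS.≈ᴹ-trans (FS.*ₗ-congʳ (R.*-comm _ _)) (FS.*ₗ-assoc _ _ _)))))
        (FS.≈ᴹ-sym (FS.*ₗ-distribˡ (d (x ↑ y)) _ _)))))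

    -- Möbius inversion for N(d)

    μ-coefficient : (Fin γ → A) → Fin γ → A
    μ-coefficient d b = RS.sum (λ x → μ x b * d x)

    -- The coefficient at b is `d b` minus the value of `d` at the next index, or just `d b` at the
    -- last one. Both matrices occur transposed, so the product to be computed is the one in `μ-ζ`,
    -- with its factors commuted.
    ζ-inversion : ∀ d z → RS.sum (λ b → ζ b z * μ-coefficient d b) R.≈ d z
    ζ-inversion d = ∑-inverse K {A = λ z b → ζ b z} {B = λ b x → μ x b}
      (λ z x → R.trans (RS.sum-cong-≋ (λ b → R.*-comm (ζ b z) (μ x b)))
        (R.trans (μ-ζ x z) (R.reflexive (δ-sym x z)))) d

    -- N is linear in d, so the decomposition of `d` carries over: the sum over b is moved innermost
    -- and `ζ-inversion` is applied at each `x ↑ y`.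
    maxSum-ζ : ∀ d → maxSum d ≈ᴹ ∑₃ (λ b → μ-coefficient d b *ₗ maxSum (ζ b))
    maxSum-ζ d = FS.≈ᴹ-sym (begin
      ∑₃ (λ b → e b *ₗ maxSum (ζ b))
        ≈⟨ ∑-cong M (λ b → FS.≈ᴹ-trans
             (*ₗ-distribˡ-∑ M (e b) (λ x → ∑₃ (λ y → ζ b (x ↑ y) *ₗ w x y)))
             (∑-cong M (λ x → FS.≈ᴹ-trans
               (*ₗ-distribˡ-∑ M (e b) (λ y → ζ b (x ↑ y) *ₗ w x y))
               (∑-cong M (λ y → FS.≈ᴹ-trans
                 (FS.≈ᴹ-sym (FS.*ₗ-assoc (e b) (ζ b (x ↑ y)) (w x y)))
                 (FS.*ₗ-congʳ (R.*-comm _ _))))))) ⟩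
      ∑₃ (λ b → ∑₃ (λ x → ∑₃ (λ y → (ζ b (x ↑ y) * e b) *ₗ w x y)))
        ≈⟨ ∑-comm M (λ b x → ∑₃ (λ y → (ζ b (x ↑ y) * e b) *ₗ w x y)) ⟩
      ∑₃ (λ x → ∑₃ (λ b → ∑₃ (λ y → (ζ b (x ↑ y) * e b) *ₗ w x y)))
        ≈⟨ ∑-cong M (λ x → FS.≈ᴹ-trans
             (∑-comm M (λ b y → (ζ b (x ↑ y) * e b) *ₗ w x y))
             (∑-cong M (λ y → FS.≈ᴹ-trans
               (FS.≈ᴹ-sym (*ₗ-distribʳ-∑ M (λ b → ζ b (x ↑ y) * e b) (w x y)))
               (FS.*ₗ-congʳ (ζ-inversion d (x ↑ y)))))) ⟩
      maxSum d ∎)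
      where
      M = F.space 3
      e = μ-coefficient d
      w : Fin γ → Fin γ → Op 3
      w x y = associator (g x) (g y)
      open SetoidReasoning (AbelianGroup.setoid (LeftModule.+ᴹ-abelianGroup M))

    -- The change of generators

    private
      Free-γ : Operad R _ _
      Free-γ = Free R (Fin γ)

    -- Kept as the same list fold as `diamond`, so that `Φ` sends a formal generator to exactly that
    -- expression; `diamonds-ζ` gives the form used in computations.
    diamonds : Fin γ → Op 2
    diamonds b = foldr _+ᴹ_ 0ᴹ (map g (filter (Fin._≤? b) (allFin γ)))

    diamonds-ζ : ∀ b → diamonds b ≈ᴹ ζ-combination b
    diamonds-ζ b = foldr-filter-≤ (F.space 2) b g

    -- Here `g b` stands for the formal diamond ◆b. The combination is ◆x minus the preceding
    -- diamond, or ◆x itself at the first index.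
    inDiamonds : Fin γ → Op 2
    inDiamonds x = ∑ (F.space 2) (λ b → μ x b *ₗ g b)

    Φ Ψ : ∀ {n} → Op n → Op n
    Φ = eval Free-γ diamonds
    Ψ = eval Free-γ inDiamonds

    Φ-homomorphism : IsOperadHomomorphism Free-γ Free-γ Φ
    Φ-homomorphism = eval-homomorphism Free-γ diamonds

    Ψ-homomorphism : IsOperadHomomorphism Free-γ Free-γ Ψ
    Ψ-homomorphism = eval-homomorphism Free-γ inDiamonds

    private
      module Φ = IsOperadHomomorphism Φ-homomorphism
      module Ψ = IsOperadHomomorphism Ψ-homomorphism

    Φ-generator : ∀ b → Φ (g b) ≈ᴹ ζ-combination b
    Φ-generator b = FS.≈ᴹ-trans (eval-generator Free-γ diamonds b) (diamonds-ζ b)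

    Ψ∘Φ : ∀ {n} (x : Op n) → Ψ (Φ x) ≈ᴹ x
    Ψ∘Φ = homomorphism-ext
      (∘-homomorphism {P = Free-γ} {Free-γ} {Free-γ} Ψ-homomorphism Φ-homomorphism)
      (id-homomorphism Free-γ) λ b → begin
      Ψ (Φ (g b))
        ≈⟨ Ψ.⟦⟧-cong (Φ-generator b) ⟩
      Ψ (ζ-combination b)
        ≈⟨ linear-combination {M = F.space 2} {F.space 2} (Ψ.linear 2) (ζ b) g ⟩
      ∑ (F.space 2) (λ x → ζ b x *ₗ Ψ (g x))
        ≈⟨ ∑-cong (F.space 2) (λ x → FS.*ₗ-congˡ (eval-generator Free-γ inDiamonds x)) ⟩
      ∑ (F.space 2) (λ x → ζ b x *ₗ inDiamonds x)
        ≈⟨ ∑-inverse (F.space 2) {A = ζ} {μ} ζ-μ g b ⟩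
      g b ∎
      where open SetoidReasoning (AbelianGroup.setoid (LeftModule.+ᴹ-abelianGroup (F.space 2)))

    Φ∘Ψ : ∀ {n} (x : Op n) → Φ (Ψ x) ≈ᴹ x
    Φ∘Ψ = homomorphism-ext
      (∘-homomorphism {P = Free-γ} {Free-γ} {Free-γ} Φ-homomorphism Ψ-homomorphism)
      (id-homomorphism Free-γ) λ x → begin
      Φ (Ψ (g x))
        ≈⟨ Φ.⟦⟧-cong (eval-generator Free-γ inDiamonds x) ⟩
      Φ (inDiamonds x)
        ≈⟨ linear-combination {M = F.space 2} {F.space 2} (Φ.linear 2) (μ x) g ⟩
      ∑ (F.space 2) (λ b → μ x b *ₗ Φ (g b))
        ≈⟨ ∑-cong (F.space 2) (λ b → FS.*ₗ-congˡ (Φ-generator b)) ⟩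
      ∑ (F.space 2) (λ b → μ x b *ₗ ζ-combination b)
        ≈⟨ ∑-inverse (F.space 2) {A = μ} {ζ} μ-ζ g x ⟩
      g x ∎
      where open SetoidReasoning (AbelianGroup.setoid (LeftModule.+ᴹ-abelianGroup (F.space 2)))

    Φ-relator : ∀ a → Φ (associator (g a) (g a)) ≈ᴹ maxSum (ζ a)
    Φ-relator a = begin
      Φ (associator (g a) (g a))
        ≈⟨ associator-homo Φ-homomorphism (g a) (g a) ⟩
      associator (Φ (g a)) (Φ (g a))
        ≈⟨ associator-cong (Φ-generator a) (Φ-generator a) ⟩
      associator (ζ-combination a) (ζ-combination a)
        ≈⟨ associator-ζ a ⟩
      maxSum (ζ a) ∎
      where open SetoidReasoning (AbelianGroup.setoid (LeftModule.+ᴹ-abelianGroup (F.space 3)))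

    -- Each N(ζ b) is the image under `Φ` of a diamond relator, and `Ψ` undoes `Φ`; so `Ψ` carries
    -- N(d) into the span of the diamond relators.
    Ψ-maxSum : ∀ d → Ψ (maxSum d) ≈ᴹ ∑₃ (λ b → μ-coefficient d b *ₗ associator (g b) (g b))
    Ψ-maxSum d = begin
      Ψ (maxSum d)
        ≈⟨ Ψ.⟦⟧-cong (maxSum-ζ d) ⟩
      Ψ (∑₃ (λ b → e b *ₗ maxSum (ζ b)))
        ≈⟨ linear-combination {M = F.space 3} {F.space 3} (Ψ.linear 3) e (λ b → maxSum (ζ b)) ⟩
      ∑₃ (λ b → e b *ₗ Ψ (maxSum (ζ b)))
        ≈⟨ ∑-cong (F.space 3) (λ b → FS.*ₗ-congˡ (Ψ.⟦⟧-cong (Φ-relator b))) ⟨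
      ∑₃ (λ b → e b *ₗ Ψ (Φ (associator (g b) (g b))))
        ≈⟨ ∑-cong (F.space 3) (λ b → FS.*ₗ-congˡ (Ψ∘Φ (associator (g b) (g b)))) ⟩
      ∑₃ (λ b → e b *ₗ associator (g b) (g b)) ∎
      where
      open SetoidReasoning (AbelianGroup.setoid (LeftModule.+ᴹ-abelianGroup (F.space 3)))
      e = μ-coefficient d

-- The annihilator of the relations of As, and the isomorphism

module _ {c ℓ₁ ℓ₂} (K : HeytingField c ℓ₁ ℓ₂) (γ : ℕ) where

  private
    module R = CommutativeRing (scalars K)
    module RP = RingProperties R.ring
    open OverCommutativeRing (scalars K)
    module FS {n} = LeftModule (Operad.space (Free (scalars K) (Fin γ)) n)
  open Operad (Free (scalars K) (Fin γ)) using (Op; _≈ᴹ_)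
  open Max (Fin.≤-totalOrder γ) using (⊔-idem) renaming (_⊔_ to _↑_)

  private
    g : Fin γ → Op 2
    g = generator (scalars K)

    Ann : Pred (Op 3) _
    Ann = Presentation.Relation (koszulDual (AsPresentation K γ))

    Rel : Pred (Op 3) _
    Rel = Presentation.Relation (DiamondPresentation K γ)

    -- The candidate for d: as `↑` is idempotent, the right comb on (x,x) pairs with N(d) to d(x).
    form₂ : Op 3 → Fin γ → R.Carrier
    form₂ u x = form (scalars K) Fin._≟_ (_∘₂_ (scalars K) (g x) (g x)) u

    -- Pairing a relator with an element unfolds to this shape, because differences in the free
    -- module are formed with the scalar -1.
    -1-cancel : ∀ {x y} → (x R.+ (R.- R.1#) R.* y) R.≈ R.0# → x R.≈ y
    -1-cancel {x} {y} x-y≈0 = RP.x∙y⁻¹≈ε⇒x≈y x y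
      (R.trans (R.+-congˡ (R.sym (RP.-1*x≈-x y))) x-y≈0)

    -1-cancel⁻¹ : ∀ {x y} → x R.≈ y → (x R.+ (R.- R.1#) R.* y) R.≈ R.0#
    -1-cancel⁻¹ {x} {y} x≈y =
      R.trans (R.+-congˡ (RP.-1*x≈-x y)) (RP.x≈y⇒x∙y⁻¹≈ε x≈y)

  -- Both combs on (a,a′) pair with N(d) to d(a ↑ a′), and so does the right comb on (a ↑ a′, a ↑
  -- a′); the relators are differences of these.
  maxSum-annihilates : ∀ d → Ann (maxSum γ d)
  maxSum-annihilates d _ = Span-kernel
    {M = Operad.space (Free (scalars K) (Fin γ)) 3} {N = regularModule {R = R.ring}}
    (form-linearˡ γ (maxSum γ d)) on-relators
    where
    form-idem : ∀ a a′ → form₂ (maxSum γ d) (a ↑ a′) R.≈ d (a ↑ a′)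
    form-idem a a′ = R.trans (form-maxSum₂ γ (a ↑ a′) (a ↑ a′) d)
      (R.reflexive (cong d (⊔-idem (a ↑ a′))))

    on-relators : ∀ {u} → AsRelator K γ u → form (scalars K) Fin._≟_ u (maxSum γ d) R.≈ R.0#
    on-relators (rel₁ a a′) = -1-cancel⁻¹ (R.trans (form-maxSum₁ γ a a′ d) (R.sym (form-idem a a′)))
    on-relators (rel₂ a a′) = -1-cancel⁻¹ (R.trans (form-maxSum₂ γ a a′ d) (R.sym (form-idem a a′)))

  -- The relators of As force both combs on (x,y) to have the same pairing with `u` as the right
  -- comb on (x ↑ y, x ↑ y), which is what `maxSum-expansion` asks for.
  annihilator⇒maxSum : ∀ {u} → Ann u → u ≈ᴹ maxSum γ (form₂ u)
  annihilator⇒maxSum {u} u∈ = maxSum-expansion γ (form₂ u) {u}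
    (λ x y → -1-cancel (u∈ _ (gen (rel₁ x y)))) (λ x y → -1-cancel (u∈ _ (gen (rel₂ x y))))

  Φ-relation : ∀ {u} → Rel u → Ideal (Free (scalars K) (Fin γ)) Ann (Φ γ u)
  Φ-relation = Span-Ideal (Free (scalars K) (Fin γ)) Ann
    (IsOperadHomomorphism.linear (Φ-homomorphism γ) 3) λ where
    -- The image of the relator is N(ζ a), which is itself a relation of the dual.
    (rel a) → resp (FS.≈ᴹ-sym (Φ-relator γ a)) (gen (maxSum-annihilates (ζ a)))

  Ψ-relation : ∀ {u} → Ann u → Ideal (Free (scalars K) (Fin γ)) Rel (Ψ γ u)
  Ψ-relation {u} u∈ = resp
    (FS.≈ᴹ-sym (FS.≈ᴹ-trans
      (IsOperadHomomorphism.⟦⟧-cong (Ψ-homomorphism γ) (annihilator⇒maxSum {u} u∈))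
      (Ψ-maxSum γ (form₂ u))))
    (∑∈ (Free (scalars K) (Fin γ)) Rel
      -- The inner `gen` places the relator in the span, the outer one places the span in the ideal.
      (λ b → *∈ (μ-coefficient γ (form₂ u) b) (gen (gen (rel b)))))

  Φ-isomorphism : IsOperadIsomorphism (scalars K) (Free (scalars K) (Fin γ) /⟨ Rel ⟩)
                                      (Free (scalars K) (Fin γ) /⟨ Ann ⟩) (Φ γ)
  Φ-isomorphism = quotient-isomorphism
    {P = Free (scalars K) (Fin γ)} {Q = Free (scalars K) (Fin γ)} {f = Φ γ} {g = Ψ γ}
    (Φ-homomorphism γ) (Ψ-homomorphism γ) (Ψ∘Φ γ) (Φ∘Ψ γ) {S = Rel} {T = Ann}
    (λ {u} → Φ-relation {u}) (λ {u} → Ψ-relation {u})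

  Φ-presented : IsOperadIsomorphism (scalars K)
    (Presented (DiamondPresentation K γ)) (Presented (koszulDual (AsPresentation K γ))) (Φ γ)
  Φ-presented = presented-isomorphism
    (DiamondPresentation K γ) (koszulDual (AsPresentation K γ)) {G = Fin γ} {H = Fin γ} refl refl
    {S = Rel} {T = Ann} {f = λ _ → Φ γ} {f′ = λ _ → Φ γ} refl refl refl Φ-isomorphism

  -- The equality holds already in the free operad, by the choice of `diamonds`, and is only passed
  -- to the quotient.
  Φ-diamond : ∀ b → Operad._≈ᴹ_ (DAs K γ) (Φ γ (g b)) (diamond K γ b)
  Φ-diamond b = ≈⇒∼ (Free (scalars K) (Presentation.Generator (koszulDual (AsPresentation K γ))))
    (Presentation.Relation (koszulDual (AsPresentation K γ)))
    (eval-generator (Free (scalars K) (Fin γ)) (diamonds γ) b)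

proposition5p1p3 : ∀ {c ℓ₁ ℓ₂} (K : HeytingField c ℓ₁ ℓ₂) → CharacteristicZero K → (γ : ℕ) →
    Presents (DiamondPresentation K γ) (DAs K γ) (diamond K γ)
proposition5p1p3 K _ γ = record
  { to            = OverCommutativeRing.Φ (scalars K) γ
  ; isIsomorphism = Φ-presented K γ
  ; to-generator  = Φ-diamond K γ
  }
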